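{- Algorithm 1, described in full in the context, solves the reconstruction problem for hv-convex polyominoes in time $O(mn\min(m^2,n^2))$. That is, given vectors $\mathbf r=(r_1,\dots,r_m)$ and $\mathbf c=(c_1,\dots,c_n)$ of strictly positive integers with $\sum_i r_i=\sum_j c_j$, Algorithm 1 outputs an hv-convex polyomino $T$ that is a realization of $(\mathbf r,\mathbf c)$ if one exists, outputs "failure" otherwise, and runs in time $O(mn\min(m^2,n^2))$.
   Context: An object is a set $T$ of cells of the grid $\{1,\dots,m\}\times\{1,\dots,n\}$, where $(i,j)$ is the cell in row $i$ and column $j$; it is identified with an $m\times n$ 0-1 matrix ($T_{i,j}=1$ iff $(i,j)\in T$). $T$ is a realization of $(\mathbf r,\mathbf c)$ if $\sum_j T_{i,j}=r_i$ for all $i$ and $\sum_i T_{i,j}=c_j$ for all $j$. $T$ is a polyomino if the graph on the cells of $T$, with $(i,j)$ and $(i',j')$ joined iff $|i-i'|+|j-j'|\le 1$, is connected. $T$ is h-convex if $(i,k),(i,l)\in T$ implies $(i,j)\in T$ for all $k\le j\le l$; v-convexity is the analogous property for columns; hv-convex means both. The reconstruction problem for hv-convex polyominoes is: given $(\mathbf r,\mathbf c)$, find an hv-convex polyomino realization of $(\mathbf r,\mathbf c)$, or report failure if none exists. The formula $F_{k,l}(\mathbf r,\mathbf c)$. For $1\le k,l\le m$, this is a 2SAT formula (conjunctive normal form with at most two literals per clause) in boolean variables $A_{i,j},B_{i,j},C_{i,j},D_{i,j}$, $1\le i\le m$, $1\le j\le n$. Convention: each of $A_{i,j},B_{i,j},C_{i,j},D_{i,j}$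 with $(i,j)$ outside $\{1,\dots,m\}\times\{1,\dots,n\}$ has value 1 (true). A bar denotes negation. $F_{k,l}(\mathbf r,\mathbf c)$ is the conjunction of the following six groups of clauses, where $i$ ranges over $1,\dots,m$ and $j$ over $1,\dots,n$ unless restricted further. (Cor) $A_{i,j}\Rightarrow A_{i-1,j}$, $A_{i,j}\Rightarrow A_{i,j-1}$, $B_{i,j}\Rightarrow B_{i-1,j}$, $B_{i,j}\Rightarrow B_{i,j+1}$, $C_{i,j}\Rightarrow C_{i+1,j}$, $C_{i,j}\Rightarrow C_{i,j-1}$, $D_{i,j}\Rightarrow D_{i+1,j}$, $D_{i,j}\Rightarrow D_{i,j+1}$, for all $i,j$. (Dis) $X_{i,j}\Rightarrow\overline{Y}_{i,j}$ for all $i,j$ and all distinct symbols $X,Y\in\{A,B,C,D\}$. (Con) $A_{i,j}\Rightarrow\overline{D}_{i+1,j+1}$ and $B_{i,j}\Rightarrow\overline{C}_{i+1,j-1}$, for all $i,j$. (Anc) $\overline A_{k,1}$, $\overline B_{k,1}$, $\overline C_{k,1}$, $\overline D_{k,1}$, $\overline A_{l,n}$, $\overline B_{l,n}$, $\overline C_{l,n}$, $\overline D_{l,n}$. (LBC) $A_{i,j}\Rightarrow\overline C_{i+c_j,j}$, $A_{i,j}\Rightarrow\overline D_{i+c_j,j}$, $B_{i,j}\Rightarrow\overline C_{i+c_j,j}$, $B_{i,j}\Rightarrow\overline D_{i+c_j,j}$ for all $i,j$; and $\overline C_{c_j,j}$, $\overline D_{c_j,j}$ for all $j$. (UBR) for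 all $j$: $\overline A_{i,j}\Rightarrow B_{i,j+r_i}$ for $i\le\min\{k,l\}$; $\overline C_{i,j}\Rightarrow B_{i,j+r_i}$ for $k\le i\le l$; $\overline A_{i,j}\Rightarrow D_{i,j+r_i}$ for $l\le i\le k$; $\overline C_{i,j}\Rightarrow D_{i,j+r_i}$ for $i\ge\max\{k,l\}$. Algorithm 1. Input: $\mathbf r\in\mathbb N^m$, $\mathbf c\in\mathbb N^n$. Without loss of generality it is assumed that $r_i\in[1,n]$ for all $i$, $c_j\in[1,m]$ for all $j$ (otherwise there is no realization), $\sum_i r_i=\sum_j c_j$, and $m\le n$ (otherwise exchange the roles of rows and columns). For each pair $k,l\in\{1,\dots,m\}$: if $F_{k,l}(\mathbf r,\mathbf c)$ is satisfiable (tested by a linear-time 2SAT algorithm), take a satisfying assignment, regard $A,B,C,D$ as the sets of grid cells $(i,j)$ where the corresponding variable is true, output $T=\overline{A\cup B\cup C\cup D}$ (complement in the grid), and halt. If no pair $(k,l)$ succeeds, output "failure". -}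

module Defs where

open import Algebra.Properties.CommutativeMonoid.Sum using ()
open import Data.Bool.Base using (Bool; true; false; if_then_else_)
open import Data.Fin.Base as Fin using (Fin; toℕ; fromℕ<)
open import Data.List.Base using (List; []; _∷_; length; foldr)
open import Data.List.Relation.Unary.All using (All)
open import Data.Maybe.Base using (Maybe; just; nothing)
open import Data.Nat.Base using (ℕ; zero; suc; _+_; _*_; _∸_; _≤_; ∣_-_∣; _≡ᵇ_)
open import Data.Nat.Properties using (+-0-commutativeMonoid; _≤?_; _<?_)
open import Data.Product.Base using (Σ; Σ-syntax; ∃; _×_; _,_; proj₁; proj₂)
open import Data.Sum.Base using (_⊎_)
open import Data.Unit.Base using (⊤)
open import Data.Empty using (⊥)
open import Data.Vec.Functional using (Vector)
open import Relation.Binary.Construct.Closure.ReflexiveTransitive using (Star)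
open import Relation.Binary.PropositionalEquality.Core using (_≡_)
open import Relation.Nullary.Decidable.Core using (does; yes; no)
open import Relation.Nullary.Negation.Core using (¬_)

open Algebra.Properties.CommutativeMonoid.Sum +-0-commutativeMonoid public using (sum)

-- Rows and columns are indexed from 0 here; the programs below use the
-- 1-based indices of the grid {1,…,m} × {1,…,n}.
Object : ℕ → ℕ → Set
Object m n = Fin m → Fin n → Bool

bit : Bool → ℕ
bit b = if b then 1 else 0

module _ {m n : ℕ} where

  IsRealization : Vector ℕ m → Vector ℕ n → Object m n → Set
  IsRealization r c T =
    (∀ i → sum (λ j → bit (T i j)) ≡ r i) × (∀ j → sum (λ i → bit (T i j)) ≡ c j)

  Cell : Object m n → Set
  Cell T = Σ[ p ∈ Fin m × Fin n ] T (proj₁ p) (proj₂ p) ≡ true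

  Adjacent : (T : Object m n) → Cell T → Cell T → Set
  Adjacent T ((i , j) , _) ((i′ , j′) , _) =
    ∣ toℕ i - toℕ i′ ∣ + ∣ toℕ j - toℕ j′ ∣ ≤ 1

  IsPolyomino : Object m n → Set
  IsPolyomino T = (p q : Cell T) → Star (Adjacent T) p q

  HConvex : Object m n → Set
  HConvex T = ∀ i k j l → k Fin.≤ j → j Fin.≤ l → T i k ≡ true → T i l ≡ true → T i j ≡ true

  VConvex : Object m n → Set
  VConvex T = ∀ j k i l → k Fin.≤ i → i Fin.≤ l → T k j ≡ true → T l j ≡ true → T i j ≡ true

  IsHVConvexPolyomino : Object m n → Set
  IsHVConvexPolyomino T = IsPolyomino T × HConvex T × VConvex T

  IsSolution : Vector ℕ m → Vector ℕ n → Object m n → Set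
  IsSolution r c T = IsHVConvexPolyomino T × IsRealization r c T

data Literal (X : Set) : Set where
  pos neg : X → Literal X

data Clause (X : Set) : Set where
  ∅    : Clause X
  unit : Literal X → Clause X
  _∨_  : Literal X → Literal X → Clause X

data Symbol : Set where
  A B C D : Symbol

-- (X , i , j) is the variable X_{i,j}.
Var : Set
Var = Symbol × ℕ × ℕ

Formula : Set
Formula = List (Clause Var)

Assignment : Set
Assignment = Var → Bool

infix 4 _⊨ˡ_ _⊨ᶜ_ _⊨_

_⊨ˡ_ : Assignment → Literal Var → Set
α ⊨ˡ pos x = α x ≡ true
α ⊨ˡ neg x = α x ≡ false

_⊨ᶜ_ : Assignment → Clause Var → Set
α ⊨ᶜ ∅        = ⊥
α ⊨ᶜ unit x   = α ⊨ˡ x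
α ⊨ᶜ (x ∨ y)  = (α ⊨ˡ x) ⊎ (α ⊨ˡ y)

_⊨_ : Assignment → Formula → Set
α ⊨ F = All (α ⊨ᶜ_) F

Satisfiable : Formula → Set
Satisfiable F = ∃ λ α → α ⊨ F

OverGridˡ : ℕ → ℕ → Literal Var → Set
OverGridˡ m n (pos (_ , i , j)) = (1 ≤ i × i ≤ m) × (1 ≤ j × j ≤ n)
OverGridˡ m n (neg (_ , i , j)) = (1 ≤ i × i ≤ m) × (1 ≤ j × j ≤ n)

OverGridᶜ : ℕ → ℕ → Clause Var → Set
OverGridᶜ m n ∅        = ⊤
OverGridᶜ m n (unit x) = OverGridˡ m n x
OverGridᶜ m n (x ∨ y)  = OverGridˡ m n x × OverGridˡ m n y

OverGrid : ℕ → ℕ → Formula → Set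
OverGrid m n F = All (OverGridᶜ m n) F

-- Number of variables plus number of clauses.
size : ℕ → ℕ → Formula → ℕ
size m n F = 4 * (m * n) + length F

-- A 2SAT procedure together with the number of steps it takes.  The first
-- two arguments declare the variables X_{i,j}, 1 ≤ i ≤ m, 1 ≤ j ≤ n.
record Solver : Set where
  field
    solve : ℕ → ℕ → Formula → Maybe Assignment
    time  : ℕ → ℕ → Formula → ℕ

record IsLinearTime2SAT (S : Solver) : Set where
  open Solver S
  field
    sound          : ∀ {m n F α} → OverGrid m n F → solve m n F ≡ just α → α ⊨ F
    complete       : ∀ {m n F} → OverGrid m n F → solve m n F ≡ nothing → ¬ Satisfiable F
    slope overhead : ℕ
    linear         : ∀ {m n F} → OverGrid m n F → time m n F ≤ slope * size m n F + overhead

-- Programs of a unit-cost random access machine with a 2SAT subroutine.  V is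
-- the type of (bound) integer registers.  A program is a value of type
-- ∀ {V} → Cmd V: since V is abstract, it can manipulate integers only through
-- instructions, each of which is charged for.

data Array : Set where
  rowSums colSums : Array

infixl 6 _⊕_ _⊖_
infix  7 _[_]

data Exp (V : Set) : Set where
  `_      : V → Exp V
  #_      : ℕ → Exp V
  #rows   : Exp V
  #cols   : Exp V
  _[_]    : Array → Exp V → Exp V
  _⊕_ _⊖_ : Exp V → Exp V → Exp V

VarExp : Set → Set
VarExp V = Symbol × Exp V × Exp V

infixr 3 _⨾_

data Cmd (V : Set) : Set where
  skip                 : Cmd V
  _⨾_                  : Cmd V → Cmd V → Cmd V
  if_≤′_then_else_     : Exp V → Exp V → Cmd V → Cmd V → Cmd V
  -- for lo hi body: the register runs over lo, lo + 1, …, hi.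
  for                  : Exp V → Exp V → (V → Cmd V) → Cmd V
  -- The formula buffer, initially empty.
  clear                : Cmd V
  emit                 : Clause (VarExp V) → Cmd V
  -- ifSat m n c d runs the subroutine on the buffer.  If it finds a satisfying
  -- assignment, this is kept for inspection by ifTrue and c is run; else d is run.
  ifSat                : Exp V → Exp V → Cmd V → Cmd V → Cmd V
  ifTrue               : VarExp V → Cmd V → Cmd V → Cmd V
  write                : Exp V → Exp V → Bool → Cmd V
  halt-output          : Cmd V
  halt-failure         : Cmd V

record State : Set where
  field
    rows cols  : ℕ
    array      : Array → ℕ → ℕ
    buffer     : Formula
    assignment : Assignment
    output     : ℕ → ℕ → Bool

open State

data Outcome : Set where
  running : State → Outcome
  success : (ℕ → ℕ → Bool) → Outcome
  failure : Outcome

Timed : Set → Set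
Timed X = ℕ × X

infixr 4 _▹_

_▹_ : {X : Set} → ℕ → Timed X → Timed X
t ▹ (t′ , x) = t + t′ , x

andThen : Timed Outcome → (State → Timed Outcome) → Timed Outcome
andThen (t , running s) f = t ▹ f s
andThen (t , success T) f = t , success T
andThen (t , failure)   f = t , failure

-- iterate N i f: run f i, f (i + 1), …, f (i + N - 1), each at one extra step.
iterate : ℕ → ℕ → (ℕ → State → Timed Outcome) → State → Timed Outcome
iterate zero    i f s = 0 , running s
iterate (suc N) i f s = 1 ▹ andThen (f i s) (iterate N (suc i) f)

value : State → Exp ℕ → ℕ
value s (` x)   = x
value s (# k)   = k
value s #rows   = rows s
value s #cols   = cols s
value s (a [ e ]) = array s a (value s e)
value s (e ⊕ f) = value s e + value s f
value s (e ⊖ f) = value s e ∸ value s f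

cost : Exp ℕ → ℕ
cost (` x)   = 1
cost (# k)   = 1
cost #rows   = 1
cost #cols   = 1
cost (a [ e ]) = 1 + cost e
cost (e ⊕ f) = 1 + cost e + cost f
cost (e ⊖ f) = 1 + cost e + cost f

valueᵛ : State → VarExp ℕ → Var
valueᵛ s (X , e , f) = X , value s e , value s f

costᵛ : VarExp ℕ → ℕ
costᵛ (X , e , f) = 1 + cost e + cost f

valueˡ : State → Literal (VarExp ℕ) → Literal Var
valueˡ s (pos x) = pos (valueᵛ s x)
valueˡ s (neg x) = neg (valueᵛ s x)

costˡ : Literal (VarExp ℕ) → ℕ
costˡ (pos x) = costᵛ x
costˡ (neg x) = costᵛ x

valueᶜ : State → Clause (VarExp ℕ) → Clause Var
valueᶜ s ∅        = ∅
valueᶜ s (unit x) = unit (valueˡ s x)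
valueᶜ s (x ∨ y)  = valueˡ s x ∨ valueˡ s y

costᶜ : Clause (VarExp ℕ) → ℕ
costᶜ ∅        = 0
costᶜ (unit x) = costˡ x
costᶜ (x ∨ y)  = costˡ x + costˡ y

update : (ℕ → ℕ → Bool) → ℕ → ℕ → Bool → ℕ → ℕ → Bool
update T i j b i′ j′ = if i ≡ᵇ i′ then (if j ≡ᵇ j′ then b else T i′ j′) else T i′ j′

module _ (S : Solver) where
  open Solver S

  run : Cmd ℕ → State → Timed Outcome
  run skip    s = 1 , running s
  run (c ⨾ d) s = andThen (run c s) (run d)
  run (if e ≤′ f then c else d) s =
    1 + cost e + cost f ▹ (if does (value s e ≤? value s f) then run c s else run d s)
  run (for e f c) s =
    1 + cost e + cost f ▹ iterate (suc (value s f) ∸ value s e) (value s e) (λ i → run (c i)) s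
  run clear    s = 1 , running (record s { buffer = [] })
  run (emit x) s = 1 + costᶜ x , running (record s { buffer = valueᶜ s x ∷ buffer s })
  run (ifSat e f c d) s
    with solve (value s e) (value s f) (buffer s)
  ... | just α  = 1 + cost e + cost f + time (value s e) (value s f) (buffer s) ▹
                  run c (record s { assignment = α })
  ... | nothing = 1 + cost e + cost f + time (value s e) (value s f) (buffer s) ▹ run d s
  run (ifTrue x c d) s =
    1 + costᵛ x ▹ (if assignment s (valueᵛ s x) then run c s else run d s)
  run (write e f b) s =
    1 + cost e + cost f ,
    running (record s { output = update (output s) (value s e) (value s f) b })
  run halt-output  s = 1 , success (output s)
  run halt-failure s = 1 , failure

module _ {V : Set} where

  block : List (Cmd V) → Cmd V
  block = foldr _⨾_ skip

  infix 8 _⟨_,_⟩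
  infix 7 ~_

  _⟨_,_⟩ : Symbol → Exp V → Exp V → Literal (VarExp V)
  X ⟨ i , j ⟩ = pos (X , i , j)

  ~_ : Literal (VarExp V) → Literal (VarExp V)
  ~ pos x = neg x
  ~ neg x = pos x

  module Build (m n : Exp V) where

    ifInGrid : VarExp V → Cmd V → Cmd V → Cmd V
    ifInGrid (_ , i , j) c d =
      if # 1 ≤′ i then
        (if i ≤′ m then
          (if # 1 ≤′ j then (if j ≤′ n then c else d) else d)
         else d)
      else d

    -- Variables outside the grid are true.
    cases : Literal (VarExp V) → (inside isTrue isFalse : Cmd V) → Cmd V
    cases (pos x) c t f = ifInGrid x c t
    cases (neg x) c t f = ifInGrid x c f

    require : Literal (VarExp V) → Cmd V
    require x = cases x (emit (unit x)) skip (emit ∅)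

    infix 5 _⇒_

    _⇒_ : Literal (VarExp V) → Literal (VarExp V) → Cmd V
    x ⇒ y = cases (~ x)
              (cases y (emit ((~ x) ∨ y)) skip (emit (unit (~ x))))
              skip
              (require y)

    cor dis con : Exp V → Exp V → Cmd V
    cor i j = block
      ( (A ⟨ i , j ⟩ ⇒ A ⟨ i ⊖ # 1 , j ⟩)
      ∷ (A ⟨ i , j ⟩ ⇒ A ⟨ i , j ⊖ # 1 ⟩)
      ∷ (B ⟨ i , j ⟩ ⇒ B ⟨ i ⊖ # 1 , j ⟩)
      ∷ (B ⟨ i , j ⟩ ⇒ B ⟨ i , j ⊕ # 1 ⟩)
      ∷ (C ⟨ i , j ⟩ ⇒ C ⟨ i ⊕ # 1 , j ⟩)
      ∷ (C ⟨ i , j ⟩ ⇒ C ⟨ i , j ⊖ # 1 ⟩)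
      ∷ (D ⟨ i , j ⟩ ⇒ D ⟨ i ⊕ # 1 , j ⟩)
      ∷ (D ⟨ i , j ⟩ ⇒ D ⟨ i , j ⊕ # 1 ⟩)
      ∷ [])
    dis i j = block
      ( (A ⟨ i , j ⟩ ⇒ ~ B ⟨ i , j ⟩)
      ∷ (A ⟨ i , j ⟩ ⇒ ~ C ⟨ i , j ⟩)
      ∷ (A ⟨ i , j ⟩ ⇒ ~ D ⟨ i , j ⟩)
      ∷ (B ⟨ i , j ⟩ ⇒ ~ A ⟨ i , j ⟩)
      ∷ (B ⟨ i , j ⟩ ⇒ ~ C ⟨ i , j ⟩)
      ∷ (B ⟨ i , j ⟩ ⇒ ~ D ⟨ i , j ⟩)
      ∷ (C ⟨ i , j ⟩ ⇒ ~ A ⟨ i , j ⟩)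
      ∷ (C ⟨ i , j ⟩ ⇒ ~ B ⟨ i , j ⟩)
      ∷ (C ⟨ i , j ⟩ ⇒ ~ D ⟨ i , j ⟩)
      ∷ (D ⟨ i , j ⟩ ⇒ ~ A ⟨ i , j ⟩)
      ∷ (D ⟨ i , j ⟩ ⇒ ~ B ⟨ i , j ⟩)
      ∷ (D ⟨ i , j ⟩ ⇒ ~ C ⟨ i , j ⟩)
      ∷ [])
    con i j = block
      ( (A ⟨ i , j ⟩ ⇒ ~ D ⟨ i ⊕ # 1 , j ⊕ # 1 ⟩)
      ∷ (B ⟨ i , j ⟩ ⇒ ~ C ⟨ i ⊕ # 1 , j ⊖ # 1 ⟩)
      ∷ [])

    anc : (k l : Exp V) → Cmd V
    anc k l = block
      ( require (~ A ⟨ k , # 1 ⟩)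
      ∷ require (~ B ⟨ k , # 1 ⟩)
      ∷ require (~ C ⟨ k , # 1 ⟩)
      ∷ require (~ D ⟨ k , # 1 ⟩)
      ∷ require (~ A ⟨ l , n ⟩)
      ∷ require (~ B ⟨ l , n ⟩)
      ∷ require (~ C ⟨ l , n ⟩)
      ∷ require (~ D ⟨ l , n ⟩)
      ∷ [])

    lbc : (c : Array) → Exp V → Exp V → Cmd V
    lbc c i j = block
      ( (A ⟨ i , j ⟩ ⇒ ~ C ⟨ i ⊕ c [ j ] , j ⟩)
      ∷ (A ⟨ i , j ⟩ ⇒ ~ D ⟨ i ⊕ c [ j ] , j ⟩)
      ∷ (B ⟨ i , j ⟩ ⇒ ~ C ⟨ i ⊕ c [ j ] , j ⟩)
      ∷ (B ⟨ i , j ⟩ ⇒ ~ D ⟨ i ⊕ c [ j ] , j ⟩)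
      ∷ [])

    lbc₀ : (c : Array) → Exp V → Cmd V
    lbc₀ c j = block
      ( require (~ C ⟨ c [ j ] , j ⟩)
      ∷ require (~ D ⟨ c [ j ] , j ⟩)
      ∷ [])

    ubr : (r : Array) (k l : Exp V) → Exp V → Exp V → Cmd V
    ubr r k l i j = block
      ( (if i ≤′ k then (if i ≤′ l then (~ A ⟨ i , j ⟩ ⇒ B ⟨ i , j ⊕ r [ i ] ⟩) else skip) else skip)
      ∷ (if k ≤′ i then (if i ≤′ l then (~ C ⟨ i , j ⟩ ⇒ B ⟨ i , j ⊕ r [ i ] ⟩) else skip) else skip)
      ∷ (if l ≤′ i then (if i ≤′ k then (~ A ⟨ i , j ⟩ ⇒ D ⟨ i , j ⊕ r [ i ] ⟩) else skip) else skip)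
      ∷ (if k ≤′ i then (if l ≤′ i then (~ C ⟨ i , j ⟩ ⇒ D ⟨ i , j ⊕ r [ i ] ⟩) else skip) else skip)
      ∷ [])

    buildF : (r c : Array) (k l : Exp V) → Cmd V
    buildF r c k l =
      clear ⨾
      (for (# 1) m λ i → for (# 1) n λ j →
        cor (` i) (` j) ⨾ dis (` i) (` j) ⨾ con (` i) (` j) ⨾
        lbc c (` i) (` j) ⨾ ubr r k l (` i) (` j)) ⨾
      (for (# 1) n λ j → lbc₀ c (` j)) ⨾
      anc k l

  failUnlessInRange : (N : Exp V) → Array → (hi : Exp V) → Cmd V
  failUnlessInRange N a hi =
    for (# 1) N λ i →
      if # 1 ≤′ a [ ` i ] then (if a [ ` i ] ≤′ hi then skip else halt-failure) else halt-failure

  writeComplement : (m n : Exp V) → (Exp V → Exp V → Bool → Cmd V) → Cmd V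
  writeComplement m n put =
    for (# 1) m λ i → for (# 1) n λ j →
      ifTrue (A , ` i , ` j) (put (` i) (` j) false)
      (ifTrue (B , ` i , ` j) (put (` i) (` j) false)
      (ifTrue (C , ` i , ` j) (put (` i) (` j) false)
      (ifTrue (D , ` i , ` j) (put (` i) (` j) false)
      (put (` i) (` j) true))))

  search : (m n : Exp V) (r c : Array) → (Exp V → Exp V → Bool → Cmd V) → Cmd V
  search m n r c put =
    (for (# 1) m λ k → for (# 1) m λ l →
      Build.buildF m n r c (` k) (` l) ⨾
      ifSat m n (writeComplement m n put ⨾ halt-output) skip) ⨾
    halt-failure

algorithm1 : ∀ {V} → Cmd V
algorithm1 =
  failUnlessInRange #rows rowSums #cols ⨾
  failUnlessInRange #cols colSums #rows ⨾
  (if #rows ≤′ #cols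
   then search #rows #cols rowSums colSums write
   else search #cols #rows colSums rowSums (λ i j → write j i))

-- 1-based access; 0 outside the bounds.
entry : ∀ {n} → Vector ℕ n → ℕ → ℕ
entry         v zero    = 0
entry {n = n} v (suc i) with i <? n
... | yes i<n = v (fromℕ< i<n)
... | no _    = 0

input : ∀ {m n} → Vector ℕ m → Vector ℕ n → State
input {m} {n} r c = record
  { rows       = m
  ; cols       = n
  ; array      = λ { rowSums → entry r ; colSums → entry c }
  ; buffer     = []
  ; assignment = λ _ → false
  ; output     = λ _ _ → false
  }

module Algorithm1 (S : Solver) {m n : ℕ} (r : Vector ℕ m) (c : Vector ℕ n) where

  execution : Timed Outcome
  execution = run S algorithm1 (input r c)

  runningTime : ℕ
  runningTime = proj₁ execution

  Outputs : Object m n → Set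
  Outputs T = ∃ λ out →
    proj₂ execution ≡ success out × (∀ i j → T i j ≡ out (suc (toℕ i)) (suc (toℕ j)))

  OutputsFailure : Set
  OutputsFailure = proj₂ execution ≡ failure

{-# OPTIONS --safe #-}
module Submission where

-- Soundness: Cor makes the complement T of the four regions hv-convex. By UBR every row
-- of T has at most r_i cells and by LBC every column at least c_j, so Σ r_i = Σ c_j forces
-- equality everywhere. If two consecutive rows of T were disjoint, then at the end of the
-- left one two opposite regions would touch diagonally, which Con forbids; so T is connected.
-- Completeness: given a solution T, let A_{i,j} say that T has no cell weakly above and to
-- the left of (i,j), similarly for B, C, D, and let k and l be rows in which T meets the
-- first and the last column. UBR holds because a path of T from a cell above row i to
-- (k,1) below row i cannot avoid the part of row i to the left of that cell.
-- Running time: each of the min(m,n)² attempts costs O(mn), as every emitted clause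
-- takes at least one step and the 2SAT call is linear.

open import Defs
open import Algebra.Properties.CommutativeMonoid.Sum using ()
open import Data.Bool.Base as Bool using (Bool; true; false; if_then_else_)
import Data.Bool.Properties as Bool
open import Data.Empty using (⊥; ⊥-elim)
open import Data.Fin.Base using (Fin; zero; suc; toℕ; fromℕ; fromℕ<)
open import Data.Fin.Properties using (toℕ<n; toℕ-fromℕ; toℕ-fromℕ<; fromℕ<-toℕ; toℕ-injective; any?)
open import Data.List.Base using ([]; _∷_; _++_; length)
open import Data.List.Properties using (++-assoc; ++-identityʳ; length-++)
open import Data.List.Relation.Unary.All using ([]; _∷_)
import Data.List.Relation.Unary.All.Properties as All
open import Data.Maybe.Base using (just; nothing)
open import Data.Nat.Base
  using (ℕ; zero; suc; _+_; _*_; _∸_; _^_; _⊓_; _≤_; _<_; _≡ᵇ_; z≤n; s≤s; s≤s⁻¹; ∣_-_∣)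
open import Data.Nat.Properties
open import Data.Product.Base using (∃; _×_; _,_; proj₁; proj₂)
open import Data.Sum.Base using (_⊎_; inj₁; inj₂)
open import Data.Unit.Base using (⊤; tt)
open import Data.Vec.Functional using (Vector)
open import Function.Base using (_$_)
open import Function.Bundles using (_⇔_; mk⇔; Equivalence)
open import Relation.Binary.Construct.Closure.ReflexiveTransitive
  using (Star; ε; _◅_; _◅◅_; reverse; gmap)
open import Relation.Binary.PropositionalEquality
  using (_≡_; refl; sym; trans; cong; cong₂; subst; subst₂)
open import Relation.Nullary.Decidable
  using (Dec; yes; no; does; _×-dec_; dec-true; dec-false; decidable-stable)
open import Relation.Nullary.Negation using (¬_; contradiction)

open Algebra.Properties.CommutativeMonoid.Sum +-0-commutativeMonoid using (∑-comm)

-- The convention that variables outside the grid are true carries content: a clause that makes a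
-- variable false also says that its cell lies in the grid, and this is how LBC keeps `c_j` cells
-- from running off a column. The solver sees grid variables only, so its assignments are completed
-- by `extend`, and the emitted formula is specified by its meaning on the completion. Each corner
-- region is a down-set for a pair of directions, so most arguments are carried out once, for an
-- arbitrary symbol, rather than four times. Since the program may halt deep inside nested loops,
-- partial correctness and time are proved together by one program logic. There the bound on the
-- time of building also bounds the number of clauses, which makes the linear 2SAT call cost O(mn).
-- The search is verified for arbitrary expressions for the two dimensions, arbitrary arrays and an
-- abstract way of writing; the case of more rows than columns is then the instance with rows and
-- columns exchanged.

true≢false : ∀ {b} → b ≡ true → b ≡ false → ⊥
true≢false refl ()

below-suc : ∀ {P : ℕ → Set} {y} → (∀ x → 1 ≤ x → x < y → P x) → P y → ∀ x → 1 ≤ x → x < suc y → P x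
below-suc h p x 1≤x x<1+y with m≤n⇒m<n∨m≡n (s≤s⁻¹ x<1+y)
... | inj₁ x<y  = h x 1≤x x<y
... | inj₂ refl = p

-- Counting

count : ∀ {n} → (Fin n → Bool) → ℕ
count f = sum (λ j → bit (f j))

bit≤1 : ∀ b → bit b ≤ 1
bit≤1 true  = ≤-refl
bit≤1 false = z≤n

count-prefix : ∀ {n} (f : Fin n → Bool) d → (∀ j → f j ≡ true → toℕ j < d) → count f ≤ d
count-prefix {zero}  f d       h = z≤n
count-prefix {suc n} f zero    h with f zero in eq
... | true  = contradiction (h zero eq) λ ()
... | false = count-prefix (λ j → f (suc j)) 0 λ j e → contradiction (h (suc j) e) λ ()
count-prefix {suc n} f (suc d) h =
  +-mono-≤ (bit≤1 (f zero)) (count-prefix (λ j → f (suc j)) d λ j e → s≤s⁻¹ (h (suc j) e))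

-- The first index at which `f` is true serves as the origin: by hypothesis all others lie less than
-- `d` beyond it.
count-diameter : ∀ {n} (f : Fin n → Bool) d →
  (∀ j j′ → f j ≡ true → f j′ ≡ true → toℕ j′ < toℕ j + d) → count f ≤ d
count-diameter {zero}  f d h = z≤n
count-diameter {suc n} f d h with f zero in eq
... | true  = subst (λ b → bit b + count (λ j → f (suc j)) ≤ d) eq
                (count-prefix f d λ j e → h zero j eq e)
... | false = count-diameter (λ j → f (suc j)) d λ j j′ e e′ → s≤s⁻¹ (h (suc j) (suc j′) e e′)

count-interval : ∀ {n} (f : Fin n → Bool) a d → a + d ≤ n →
  (∀ j → a ≤ toℕ j → toℕ j < a + d → f j ≡ true) → d ≤ count f
count-interval {zero}  f zero    zero    _ h = z≤n
count-interval {suc n} f zero    zero    _ h = z≤n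
count-interval {suc n} f zero    (suc d) l h rewrite h zero z≤n (s≤s z≤n) =
  s≤s (count-interval (λ j → f (suc j)) 0 d (s≤s⁻¹ l) λ j _ q → h (suc j) z≤n (s≤s q))
count-interval {suc n} f (suc a) d       l h =
  ≤-trans (count-interval (λ j → f (suc j)) a d (s≤s⁻¹ l) λ j p q → h (suc j) (s≤s p) (s≤s q))
          (m≤n+m _ (bit (f zero)))

count≤n : ∀ {n} (f : Fin n → Bool) → count f ≤ n
count≤n f = count-prefix f _ λ j _ → toℕ<n j

find : ∀ {n} (f : Fin n → Bool) → (∃ λ j → f j ≡ true) ⊎ (∀ j → f j ≡ false)
find {zero}  f = inj₂ λ ()
find {suc n} f with f zero in eq | find (λ j → f (suc j))
... | true  | _            = inj₁ (zero , eq)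
... | false | inj₁ (j , e) = inj₁ (suc j , e)
... | false | inj₂ h       = inj₂ λ { zero → eq ; (suc j) → h j }

count-positive : ∀ {n} (f : Fin n → Bool) → 1 ≤ count f → ∃ λ j → f j ≡ true
count-positive f 1≤ with find f
... | inj₁ p = p
... | inj₂ h = contradiction
  (≤-trans 1≤ (count-prefix f 0 λ j e → ⊥-elim (true≢false e (h j)))) λ ()

sum-mono : ∀ {n} (f g : Vector ℕ n) → (∀ i → f i ≤ g i) → sum f ≤ sum g
sum-mono {zero}  f g h = z≤n
sum-mono {suc n} f g h = +-mono-≤ (h zero) (sum-mono (λ i → f (suc i)) (λ i → g (suc i)) λ i → h (suc i))

-- Slack in one term cannot be made up by the others, so the reversed inequality of the totals
-- leaves none.
sum-squeeze : ∀ {n} (f g : Vector ℕ n) → (∀ i → f i ≤ g i) → sum g ≤ sum f → ∀ i → f i ≡ g i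
sum-squeeze {suc n} f g h l = λ
  { zero → ≤-antisym (h zero) (+-cancelʳ-≤ (sum f′) (g zero) (f zero)
             (≤-trans (+-monoʳ-≤ (g zero) (sum-mono f′ g′ h′)) l))
  ; (suc i) → sum-squeeze f′ g′ h′ (+-cancelˡ-≤ (f zero) (sum g′) (sum f′)
             (≤-trans (+-monoˡ-≤ (sum g′) (h zero)) l)) i }
  where
  f′ = λ i → f (suc i)
  g′ = λ i → g (suc i)
  h′ = λ i → h (suc i)

-- The row and column bounds point in opposite directions, so double counting makes both tight.
sums-tight : ∀ {m n} (r : Vector ℕ m) (c : Vector ℕ n) (T : Object m n) → sum r ≡ sum c →
  (∀ i → count (T i) ≤ r i) → (∀ j → c j ≤ count (λ i → T i j)) → IsRealization r c T
sums-tight r c T r≡c short long =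
  sum-squeeze rows r short (subst (_≤ sum rows) (sym r≡c) (≤-trans (sum-mono c cols long) (≤-reflexive (sym double)))) ,
  λ j → sym (sum-squeeze c cols long (≤-trans (≤-reflexive (sym double)) (≤-trans (sum-mono rows r short) (≤-reflexive r≡c))) j)
  where
  rows = λ i → count (T i)
  cols = λ j → count (λ i → T i j)
  double : sum rows ≡ sum cols
  double = ∑-comm (λ i j → bit (T i j))

-- Grid coordinates and orders along a direction

position : ∀ {n} → Fin n → ℕ
position i = suc (toℕ i)

1≤position : ∀ {n} (i : Fin n) → 1 ≤ position i
1≤position i = s≤s z≤n

position≤n : ∀ {n} (i : Fin n) → position i ≤ n
position≤n = toℕ<n

-- A view of the integers from 1 to `n`: matching on `at` turns a coordinate of the program into an
-- index of a vector.
data IsPosition {n : ℕ} : ℕ → Set where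
  at : (i : Fin n) → IsPosition (position i)

isPosition : ∀ {n i} → 1 ≤ i → i ≤ n → IsPosition {n} i
isPosition {i = suc i} _ i<n = subst (λ x → IsPosition (suc x)) (toℕ-fromℕ< i<n) (at (fromℕ< i<n))

entry-position : ∀ {n} (v : Vector ℕ n) i → entry v (position i) ≡ v i
entry-position {n} v i with toℕ i <? n
... | yes i<n = cong v (fromℕ<-toℕ i i<n)
... | no  i≮n = contradiction (toℕ<n i) i≮n

data Direction : Set where
  fwd bwd : Direction

infix 4 _≤[_]_ _≤[_]?_

_≤[_]_ : ℕ → Direction → ℕ → Set
x ≤[ fwd ] y = x ≤ y
x ≤[ bwd ] y = y ≤ x

_≤[_]?_ : ∀ x d y → Dec (x ≤[ d ] y)
x ≤[ fwd ]? y = x ≤? y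
x ≤[ bwd ]? y = y ≤? x

≤[]-refl : ∀ d {x} → x ≤[ d ] x
≤[]-refl fwd = ≤-refl
≤[]-refl bwd = ≤-refl

≤[]-trans : ∀ d {x y z} → x ≤[ d ] y → y ≤[ d ] z → x ≤[ d ] z
≤[]-trans fwd p q = ≤-trans p q
≤[]-trans bwd p q = ≤-trans q p

≤[]-antisym : ∀ d {x y} → x ≤[ d ] y → y ≤[ d ] x → x ≡ y
≤[]-antisym fwd p q = ≤-antisym p q
≤[]-antisym bwd p q = ≤-antisym q p

≰[]⇒≥ : ∀ d {x y} → ¬ x ≤[ d ] y → y ≤[ d ] x
≰[]⇒≥ fwd p = ≰⇒≥ p
≰[]⇒≥ bwd p = ≰⇒≥ p

-- The direction decides which end precedes the middle. Hence a region that contains a cell between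
-- two cells of a line contains one of the two, which is what convexity rests on.
≤[]-between : ∀ d {x y z} → x ≤ y → y ≤ z → x ≤[ d ] y ⊎ z ≤[ d ] y
≤[]-between fwd p q = inj₁ p
≤[]-between bwd p q = inj₂ q

∣m-n∣≤1⇒m≤1+n : ∀ {m n} → ∣ m - n ∣ ≤ 1 → m ≤ suc n
∣m-n∣≤1⇒m≤1+n {m} {n} p =
  ≤-trans (m≤n+∣m-n∣ m n) (≤-trans (+-monoʳ-≤ n p) (≤-reflexive (+-comm n 1)))

-- A unit step cannot jump over the threshold `z`; if it crosses, it lands on it.
≤[]-step : ∀ d {x y z} → ∣ x - y ∣ ≤ 1 → ¬ x ≤[ d ] z → y ≤[ d ] z → y ≡ z
≤[]-step fwd p x≰z y≤z = ≤-antisym y≤z (s≤s⁻¹ (≤-trans (≰⇒> x≰z) (∣m-n∣≤1⇒m≤1+n p)))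
≤[]-step bwd {x} {y} p z≰x z≤y =
  ≤-antisym (≤-trans (∣m-n∣≤1⇒m≤1+n (subst (_≤ 1) (∣-∣-comm x y) p)) (≰⇒> z≰x)) z≤y

-- With a cell, a region contains all cells that precede it in these directions.
rowDirection colDirection : Symbol → Direction
rowDirection A = fwd
rowDirection B = fwd
rowDirection C = bwd
rowDirection D = bwd
colDirection A = fwd
colDirection B = bwd
colDirection C = fwd
colDirection D = bwd

-- The meaning of the formula

InGrid : ℕ → ℕ → ℕ → ℕ → Set
InGrid m n i j = (1 ≤ i × i ≤ m) × (1 ≤ j × j ≤ n)

module Constraints (m n : ℕ) (ρ γ : ℕ → ℕ) (k l : ℕ) (X : Assignment) where

  infix 5 _⟹_ _⟹¬_ _¬⟹_
  _⟹_ _⟹¬_ _¬⟹_ : Var → Var → Set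
  x ⟹ y  = X x ≡ true → X y ≡ true
  x ⟹¬ y = X x ≡ true → X y ≡ false
  x ¬⟹ y = X x ≡ false → X y ≡ true

  -- The products follow the order of the emitted clauses and end in `⊤` for the closing `skip` of
  -- `block`, so that composing the specifications of the commands yields these very types. At index
  -- 1, `∸ 1` gives 0, which is outside the grid.
  Cor Dis Con Lbc Ubr : ℕ → ℕ → Set
  Cor i j =
      ((A , i , j) ⟹ (A , i ∸ 1 , j)) × ((A , i , j) ⟹ (A , i , j ∸ 1))
    × ((B , i , j) ⟹ (B , i ∸ 1 , j)) × ((B , i , j) ⟹ (B , i , j + 1))
    × ((C , i , j) ⟹ (C , i + 1 , j)) × ((C , i , j) ⟹ (C , i , j ∸ 1))
    × ((D , i , j) ⟹ (D , i + 1 , j)) × ((D , i , j) ⟹ (D , i , j + 1)) × ⊤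
  Dis i j =
      ((A , i , j) ⟹¬ (B , i , j)) × ((A , i , j) ⟹¬ (C , i , j)) × ((A , i , j) ⟹¬ (D , i , j))
    × ((B , i , j) ⟹¬ (A , i , j)) × ((B , i , j) ⟹¬ (C , i , j)) × ((B , i , j) ⟹¬ (D , i , j))
    × ((C , i , j) ⟹¬ (A , i , j)) × ((C , i , j) ⟹¬ (B , i , j)) × ((C , i , j) ⟹¬ (D , i , j))
    × ((D , i , j) ⟹¬ (A , i , j)) × ((D , i , j) ⟹¬ (B , i , j)) × ((D , i , j) ⟹¬ (C , i , j)) × ⊤
  Con i j = ((A , i , j) ⟹¬ (D , i + 1 , j + 1)) × ((B , i , j) ⟹¬ (C , i + 1 , j ∸ 1)) × ⊤
  Lbc i j =
      ((A , i , j) ⟹¬ (C , i + γ j , j)) × ((A , i , j) ⟹¬ (D , i + γ j , j))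
    × ((B , i , j) ⟹¬ (C , i + γ j , j)) × ((B , i , j) ⟹¬ (D , i + γ j , j)) × ⊤
  Ubr i j =
      (i ≤ k → i ≤ l → (A , i , j) ¬⟹ (B , i , j + ρ i))
    × (k ≤ i → i ≤ l → (C , i , j) ¬⟹ (B , i , j + ρ i))
    × (l ≤ i → i ≤ k → (A , i , j) ¬⟹ (D , i , j + ρ i))
    × (k ≤ i → l ≤ i → (C , i , j) ¬⟹ (D , i , j + ρ i)) × ⊤

  CellConstraint : ℕ → ℕ → Set
  CellConstraint i j = Cor i j × Dis i j × Con i j × Lbc i j × Ubr i j

  Lbc₀ : ℕ → Set
  Lbc₀ j = X (C , γ j , j) ≡ false × X (D , γ j , j) ≡ false × ⊤

  Anc : Set
  Anc = X (A , k , 1) ≡ false × X (B , k , 1) ≡ false × X (C , k , 1) ≡ false × X (D , k , 1) ≡ false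
      × X (A , l , n) ≡ false × X (B , l , n) ≡ false × X (C , l , n) ≡ false × X (D , l , n) ≡ false × ⊤

  AllConstraints : Set
  AllConstraints =
      (∀ i → 1 ≤ i → i ≤ m → ∀ j → 1 ≤ j → j ≤ n → CellConstraint i j)
    × (∀ j → 1 ≤ j → j ≤ n → Lbc₀ j)
    × Anc

TrueOutside : ℕ → ℕ → Assignment → Set
TrueOutside m n X = ∀ Y i j → ¬ InGrid m n i j → X (Y , i , j) ≡ true

complement : Assignment → ℕ → ℕ → Bool
complement X i j =
  if X (A , i , j) then false else
  if X (B , i , j) then false else
  if X (C , i , j) then false else
  if X (D , i , j) then false else true

complement-true : ∀ X i j → complement X i j ≡ true → ∀ Y → X (Y , i , j) ≡ false
complement-true X i j e Y with X (A , i , j) in a | X (B , i , j) in b | X (C , i , j) in c | X (D , i , j) in d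
complement-true X i j e A | false | false | false | false = a
complement-true X i j e B | false | false | false | false = b
complement-true X i j e C | false | false | false | false = c
complement-true X i j e D | false | false | false | false = d

complement-false : ∀ X i j → complement X i j ≡ false → ∃ λ Y → X (Y , i , j) ≡ true
complement-false X i j e with X (A , i , j) in a | X (B , i , j) in b | X (C , i , j) in c | X (D , i , j) in d
... | true  | _     | _     | _     = A , a
... | false | true  | _     | _     = B , b
... | false | false | true  | _     = C , c
... | false | false | false | true  = D , d

complement-free : ∀ X i j → (∀ Y → ¬ X (Y , i , j) ≡ true) → complement X i j ≡ true
complement-free X i j free with complement X i j in e
... | true  = refl
... | false = let Y , x = complement-false X i j e in contradiction x (free Y)

-- A discrete intermediate value theorem, used to find where a row of `T` ends.
last-true : (f : ℕ → Bool) → ∀ {x y} → x ≤ y → f x ≡ true → f y ≡ false →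
  ∃ λ z → x ≤ z × z < y × f z ≡ true × f (suc z) ≡ false
last-true f {y = zero} z≤n fx fy = ⊥-elim (true≢false fx fy)
last-true f {x} {suc y} x≤1+y fx fy with m≤n⇒m<n∨m≡n x≤1+y
... | inj₂ refl = ⊥-elim (true≢false fx fy)
... | inj₁ x<1+y with f y in e
...   | true  = y , s≤s⁻¹ x<1+y , ≤-refl , e , fy
...   | false =
  let z , x≤z , z<y , fz , fz′ = last-true f (s≤s⁻¹ x<1+y) fx e
  in  z , x≤z , m≤n⇒m≤1+n z<y , fz , fz′

-- Cor relates neighbouring cells only; iterating it from inside the grid gives closure along a
-- whole line.
downward : (P : ℕ → Set) (N : ℕ) → (∀ x → 1 ≤ x → x ≤ N → P x → P (x ∸ 1)) →
  ∀ {x y} → y ≤ x → x ≤ N → P x → P y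
downward P N step {zero}  z≤n x≤N p = p
downward P N step {suc x} {y} y≤x x≤N p with m≤n⇒m<n∨m≡n y≤x
... | inj₂ refl = p
... | inj₁ y<1+x = downward P N step (s≤s⁻¹ y<1+x) (<⇒≤ x≤N) (step (suc x) (s≤s z≤n) x≤N p)

upward : (P : ℕ → Set) (N : ℕ) → (∀ x → 1 ≤ x → x ≤ N → P x → P (x + 1)) →
  ∀ {x y} → x ≤ y → 1 ≤ x → y ≤ N → P x → P y
upward P N step {y = zero} z≤n 1≤x y≤N p = p
upward P N step {x} {suc y} x≤1+y 1≤x y<N p with m≤n⇒m<n∨m≡n x≤1+y
... | inj₂ refl = p
... | inj₁ x<1+y =
  subst P (+-comm y 1)
    (step y (≤-trans 1≤x x≤y) (<⇒≤ y<N) (upward P N step x≤y 1≤x (<⇒≤ y<N) p))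
  where x≤y = s≤s⁻¹ x<1+y

-- Connectedness from consecutive rows that meet

Adjacent-sym : ∀ {m n} (T : Object m n) {p q : Cell T} → Adjacent T p q → Adjacent T q p
Adjacent-sym T {(i , j) , _} {(i′ , j′) , _} =
  subst₂ (λ x y → x + y ≤ 1) (∣-∣-comm (toℕ i) (toℕ i′)) (∣-∣-comm (toℕ j) (toℕ j′))

∣n-1+n∣≡1 : ∀ n → ∣ n - suc n ∣ ≡ 1
∣n-1+n∣≡1 zero    = refl
∣n-1+n∣≡1 (suc n) = ∣n-1+n∣≡1 n

module RowChain {m n : ℕ} (T : Object m n) (hconvex : HConvex T)
  (rowsMeet : ∀ i i′ → toℕ i′ ≡ suc (toℕ i) → ∃ λ j → T i j ≡ true × T i′ j ≡ true) where

  rowPath≤ : ∀ d i j j′ (e : T i j ≡ true) (e′ : T i j′ ≡ true) → toℕ j′ ≡ d + toℕ j →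
    Star (Adjacent T) ((i , j) , e) ((i , j′) , e′)
  -- The two cells agree but carry different membership proofs; since adjacency includes distance 0,
  -- one step joins them.
  rowPath≤ zero    i j j′ e e′ eq =
    ≤-trans (≤-reflexive (trans (cong (∣ toℕ i - toℕ i ∣ +_) (m≡n⇒∣m-n∣≡0 (sym eq))) (trans (+-identityʳ _) (∣n-n∣≡0 (toℕ i))))) z≤n
    ◅ ε
  rowPath≤ (suc d) i j j′ e e′ eq =
    ≤-reflexive (trans (cong (_+ ∣ toℕ j - toℕ j⁺ ∣) (∣n-n∣≡0 (toℕ i))) (trans (cong (∣ toℕ j -_∣) j⁺≡) (∣n-1+n∣≡1 (toℕ j))))
    ◅ rowPath≤ d i j⁺ j′ e⁺ e′ (trans eq (trans (sym (+-suc d (toℕ j))) (cong (d +_) (sym j⁺≡))))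
    where
    j<j′ : toℕ j < toℕ j′
    j<j′ = ≤-trans (s≤s (m≤n+m (toℕ j) d)) (≤-reflexive (sym eq))
    bound : suc (toℕ j) < n
    bound = ≤-trans (s≤s j<j′) (toℕ<n j′)
    j⁺ = fromℕ< bound
    j⁺≡ = toℕ-fromℕ< bound
    e⁺ : T i j⁺ ≡ true
    e⁺ = hconvex i j j⁺ j′ (≤-trans (n≤1+n _) (≤-reflexive (sym j⁺≡))) (≤-trans (≤-reflexive j⁺≡) j<j′) e e′

  path-sym : ∀ {p q : Cell T} → Star (Adjacent T) p q → Star (Adjacent T) q p
  path-sym = reverse (λ {p} {q} → Adjacent-sym T {p} {q})

  rowPath : ∀ i j j′ (e : T i j ≡ true) (e′ : T i j′ ≡ true) →
    Star (Adjacent T) ((i , j) , e) ((i , j′) , e′)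
  rowPath i j j′ e e′ with ≤-total (toℕ j) (toℕ j′)
  ... | inj₁ p = rowPath≤ _ i j j′ e e′ (sym (m∸n+n≡m p))
  ... | inj₂ p = path-sym (rowPath≤ _ i j′ j e′ e (sym (m∸n+n≡m p)))

  -- Walk along row `i` to a column shared with the next row, step down, and continue from there.
  path≤ : ∀ d i i′ j j′ (e : T i j ≡ true) (e′ : T i′ j′ ≡ true) → toℕ i′ ≡ d + toℕ i →
    Star (Adjacent T) ((i , j) , e) ((i′ , j′) , e′)
  path≤ zero    i i′ j j′ e e′ eq with toℕ-injective eq
  ... | refl = rowPath i j j′ e e′
  path≤ (suc d) i i′ j j′ e e′ eq =
    rowPath i j x e ex ◅◅
    (≤-reflexive (trans (cong (∣ toℕ i - toℕ i⁺ ∣ +_) (∣n-n∣≡0 (toℕ x)))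
      (trans (+-identityʳ _) (trans (cong (∣ toℕ i -_∣) i⁺≡) (∣n-1+n∣≡1 (toℕ i)))))
    ◅ path≤ d i⁺ i′ x j′ ex⁺ e′ (trans eq (trans (sym (+-suc d (toℕ i))) (cong (d +_) (sym i⁺≡)))))
    where
    bound : suc (toℕ i) < m
    bound = ≤-trans (s≤s (≤-trans (s≤s (m≤n+m (toℕ i) d)) (≤-reflexive (sym eq)))) (toℕ<n i′)
    i⁺ = fromℕ< bound
    i⁺≡ = toℕ-fromℕ< bound
    x = proj₁ (rowsMeet i i⁺ i⁺≡)
    ex = proj₁ (proj₂ (rowsMeet i i⁺ i⁺≡))
    ex⁺ = proj₂ (proj₂ (rowsMeet i i⁺ i⁺≡))

  isPolyomino : IsPolyomino T
  isPolyomino ((i , j) , e) ((i′ , j′) , e′) with ≤-total (toℕ i) (toℕ i′)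
  ... | inj₁ p = path≤ _ i i′ j j′ e e′ (sym (m∸n+n≡m p))
  ... | inj₂ p = path-sym (path≤ _ i′ i j′ j e′ e (sym (m∸n+n≡m p)))

-- Satisfying assignments yield solutions

module Soundness {m n : ℕ} (r : Vector ℕ m) (c : Vector ℕ n) (k l : ℕ) (X : Assignment)
  (outside : TrueOutside m n X)
  (cells : ∀ i → 1 ≤ i → i ≤ m → ∀ j → 1 ≤ j → j ≤ n →
    Constraints.CellConstraint m n (entry r) (entry c) k l X i j)
  (columns : ∀ j → 1 ≤ j → j ≤ n → Constraints.Lbc₀ m n (entry r) (entry c) k l X j) where

  open Constraints m n (entry r) (entry c) k l X

  rowClosed : ∀ Y {i i′ j} → i′ ≤[ rowDirection Y ] i → 1 ≤ i → i ≤ m → i′ ≤ m → 1 ≤ j → j ≤ n →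
    X (Y , i , j) ≡ true → X (Y , i′ , j) ≡ true
  rowClosed A p _ q _ s t = downward (λ x → X (A , x , _) ≡ true) m
    (λ x u v → let (a , _) , _ = cells x u v _ s t in a) p q
  rowClosed B p _ q _ s t = downward (λ x → X (B , x , _) ≡ true) m
    (λ x u v → let (_ , _ , a , _) , _ = cells x u v _ s t in a) p q
  rowClosed C p o _ q s t = upward (λ x → X (C , x , _) ≡ true) m
    (λ x u v → let (_ , _ , _ , _ , a , _) , _ = cells x u v _ s t in a) p o q
  rowClosed D p o _ q s t = upward (λ x → X (D , x , _) ≡ true) m
    (λ x u v → let (_ , _ , _ , _ , _ , _ , a , _) , _ = cells x u v _ s t in a) p o q

  colClosed : ∀ Y {i j j′} → j′ ≤[ colDirection Y ] j → 1 ≤ j → j ≤ n → j′ ≤ n → 1 ≤ i → i ≤ m →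
    X (Y , i , j) ≡ true → X (Y , i , j′) ≡ true
  colClosed A p _ q _ s t = downward (λ x → X (A , _ , x) ≡ true) n
    (λ x u v → let (_ , a , _) , _ = cells _ s t x u v in a) p q
  colClosed B p o _ q s t = upward (λ x → X (B , _ , x) ≡ true) n
    (λ x u v → let (_ , _ , _ , a , _) , _ = cells _ s t x u v in a) p o q
  colClosed C p _ q _ s t = downward (λ x → X (C , _ , x) ≡ true) n
    (λ x u v → let (_ , _ , _ , _ , _ , a , _) , _ = cells _ s t x u v in a) p q
  colClosed D p o _ q s t = upward (λ x → X (D , _ , x) ≡ true) n
    (λ x u v → let (_ , _ , _ , _ , _ , _ , _ , a , _) , _ = cells _ s t x u v in a) p o q

  t : ℕ → ℕ → Bool
  t = complement X

  T : Object m n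
  T i j = t (position i) (position j)

  free : ∀ {i j} Y → t i j ≡ true → ¬ X (Y , i , j) ≡ true
  free {i} {j} Y e x = true≢false x (complement-true X i j e Y)

  -- A gap in a row would belong to some region `Y`, which by Cor spreads to one of the two ends,
  -- and these are cells of `T`.
  hconvex : HConvex T
  hconvex i p j q p≤j j≤q ep eq with T i j in e
  ... | true  = refl
  ... | false with complement-false X _ _ e
  ...   | Y , x with ≤[]-between (colDirection Y) (s≤s p≤j) (s≤s j≤q)
  ...     | inj₁ h = contradiction (colClosed Y h (1≤position j) (position≤n j) (position≤n p) (1≤position i) (position≤n i) x) (free Y ep)
  ...     | inj₂ h = contradiction (colClosed Y h (1≤position j) (position≤n j) (position≤n q) (1≤position i) (position≤n i) x) (free Y eq)

  vconvex : VConvex T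
  vconvex j p i q p≤i i≤q ep eq with T i j in e
  ... | true  = refl
  ... | false with complement-false X _ _ e
  ...   | Y , x with ≤[]-between (rowDirection Y) (s≤s p≤i) (s≤s i≤q)
  ...     | inj₁ h = contradiction (rowClosed Y h (1≤position i) (position≤n i) (position≤n p) (1≤position j) (position≤n j) x) (free Y ep)
  ...     | inj₂ h = contradiction (rowClosed Y h (1≤position i) (position≤n i) (position≤n q) (1≤position j) (position≤n j) x) (free Y eq)

  -- However `i` compares with `k` and `l`, one of the four cases of UBR applies, and in each the
  -- second region is one that extends to the right border.
  rowBoundary : ∀ i → 1 ≤ i → i ≤ m → ∃ λ Y → ∃ λ Z → colDirection Z ≡ bwd ×
    (∀ j → 1 ≤ j → j ≤ n → (Y , i , j) ¬⟹ (Z , i , j + entry r i))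
  rowBoundary i p q with ≤-total i k | ≤-total i l
  ... | inj₁ i≤k | inj₁ i≤l = A , B , refl , λ j u v →
    let _ , _ , _ , _ , (h , _) = cells i p q j u v in h i≤k i≤l
  ... | inj₂ k≤i | inj₁ i≤l = C , B , refl , λ j u v →
    let _ , _ , _ , _ , (_ , h , _) = cells i p q j u v in h k≤i i≤l
  ... | inj₁ i≤k | inj₂ l≤i = A , D , refl , λ j u v →
    let _ , _ , _ , _ , (_ , _ , h , _) = cells i p q j u v in h l≤i i≤k
  ... | inj₂ k≤i | inj₂ l≤i = C , D , refl , λ j u v →
    let _ , _ , _ , _ , (_ , _ , _ , h , _) = cells i p q j u v in h k≤i l≤i

  -- At a cell of `T` the first region of UBR is false, so the second holds `r i` columns further on
  -- and, by Cor, everywhere beyond; no cell of `T` can be that far away.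
  rowsShort : ∀ i → count (T i) ≤ r i
  rowsShort i = count-diameter (T i) (r i) close
    where
    close : ∀ j j′ → T i j ≡ true → T i j′ ≡ true → toℕ j′ < toℕ j + r i
    close j j′ e e′ with toℕ j′ <? toℕ j + r i
    ... | yes p = p
    ... | no  p with rowBoundary (position i) (1≤position i) (position≤n i)
    ...   | Y , Z , dir , h =
      contradiction
        (colClosed Z (subst (position j′ ≤[_] position j + entry r (position i)) (sym dir) far)
          (s≤s z≤n) (≤-trans far (position≤n j′)) (position≤n j′) (1≤position i) (position≤n i)
          (h (position j) (1≤position j) (position≤n j) (complement-true X _ _ e Y)))
        (free Z e′)
      where
      far : position j + entry r (position i) ≤ position j′
      far rewrite entry-position r i = s≤s (≮⇒≥ p)

  -- The convention for variables outside the grid, read backwards: falsity of a variable locates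
  -- its cell.
  insideGrid : ∀ Y {i j} → X (Y , i , j) ≡ false → ¬ ¬ InGrid m n i j
  insideGrid Y e ¬g = true≢false (outside Y _ _ ¬g) e

  -- Row 0 stands for a column that does not meet A and B.
  data LowestTop (j : ℕ) : ℕ → Set where
    none : LowestTop j 0
    some : ∀ {i} Y → rowDirection Y ≡ fwd → 1 ≤ i → X (Y , i , j) ≡ true → LowestTop j i

  lowestTop : ∀ j N → ∃ λ i → i ≤ N × LowestTop j i ×
    (∀ x → i < x → x ≤ N → ∀ Y → rowDirection Y ≡ fwd → X (Y , x , j) ≡ false)
  lowestTop j zero = 0 , z≤n , none , λ { x p q → contradiction (≤-trans p q) λ () }
  lowestTop j (suc N) with X (A , suc N , j) in a | X (B , suc N , j) in b
  ... | true  | _    = suc N , ≤-refl , some A refl (s≤s z≤n) a , λ x p q → contradiction (≤-trans p q) 1+n≰n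
  ... | false | true = suc N , ≤-refl , some B refl (s≤s z≤n) b , λ x p q → contradiction (≤-trans p q) 1+n≰n
  ... | false | false with lowestTop j N
  ...   | i , i≤N , top , below = i , m≤n⇒m≤1+n i≤N , top , below′
    where
    below′ : ∀ x → i < x → x ≤ suc N → ∀ Y → rowDirection Y ≡ fwd → X (Y , x , j) ≡ false
    below′ x p q Y d with m≤n⇒m<n∨m≡n q
    ... | inj₁ x<1+N = below x p (s≤s⁻¹ x<1+N) Y d
    below′ x p q A d | inj₂ refl = a
    below′ x p q B d | inj₂ refl = b

  -- The clauses on row `c_j` alone act as LBC for row 0, whence the index of `none`.
  bottomClear : ∀ {i j} → 1 ≤ j → j ≤ n → i ≤ m → LowestTop j i →
    ∀ Y → rowDirection Y ≡ bwd → X (Y , i + entry c j , j) ≡ false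
  bottomClear p q _ none C _ = proj₁ (columns _ p q)
  bottomClear p q _ none D _ = proj₁ (proj₂ (columns _ p q))
  bottomClear p q u (some A _ v x) C _ = let _ , _ , _ , (h , _) , _ = cells _ v u _ p q in h x
  bottomClear p q u (some A _ v x) D _ = let _ , _ , _ , (_ , h , _) , _ = cells _ v u _ p q in h x
  bottomClear p q u (some B _ v x) C _ = let _ , _ , _ , (_ , _ , h , _) , _ = cells _ v u _ p q in h x
  bottomClear p q u (some B _ v x) D _ = let _ , _ , _ , (_ , _ , _ , h , _) , _ = cells _ v u _ p q in h x

  -- Let `a` be the lowest row of the column that meets `A` or `B`. LBC excludes `C` and `D` from
  -- row `a + c j`, which therefore lies in the grid, and by Cor they are absent from all rows above
  -- it. So rows `a + 1` to `a + c j`, 0-based from `a` on, belong to `T`.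
  columnsLong : ∀ j → c j ≤ count (λ i → T i j)
  columnsLong j with lowestTop (position j) m
  ... | a , a≤m , top , below =
    count-interval (λ i → T i j) a (c j) fits λ i p q →
      complement-free X _ _ λ Y x → unclaimed i p q Y (rowDirection Y) refl x
    where
    clearAt : ∀ Y → rowDirection Y ≡ bwd → X (Y , a + c j , position j) ≡ false
    clearAt Y d = subst (λ z → X (Y , a + z , position j) ≡ false) (entry-position c j)
      (bottomClear (1≤position j) (position≤n j) a≤m top Y d)
    fits : a + c j ≤ m
    fits with a + c j ≤? m
    ... | yes p = p
    ... | no  p = ⊥-elim (insideGrid C (clearAt C refl) λ { ((_ , q) , _) → p q })
    unclaimed : ∀ i → a ≤ toℕ i → toℕ i < a + c j → ∀ Y d → rowDirection Y ≡ d →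
      ¬ X (Y , position i , position j) ≡ true
    unclaimed i p q Y fwd d x = true≢false x (below (position i) (s≤s p) (position≤n i) Y d)
    unclaimed i p q Y bwd d x = true≢false
      (rowClosed Y (subst (a + c j ≤[_] position i) (sym d) q) (1≤position i) (position≤n i) fits
        (1≤position j) (position≤n j) x)
      (clearAt Y d)

  module _ (positive : ∀ i → 1 ≤ r i) (balanced : sum r ≡ sum c) where

    realization : IsRealization r c T
    realization = sums-tight r c T balanced rowsShort columnsLong

    rowInhabited : ∀ i → ∃ λ j → T i j ≡ true
    rowInhabited i = count-positive (T i) (subst (1 ≤_) (sym (proj₁ realization i)) (positive i))

    module _ {i : ℕ} (1≤i : 1 ≤ i) (i<m : suc i ≤ m)
      (disjoint : ∀ j → 1 ≤ j → j ≤ n → t i j ≡ true → t (suc i) j ≡ false) where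

      private i≤m = <⇒≤ i<m

      disjoint′ : ∀ j → 1 ≤ j → j ≤ n → t (suc i) j ≡ true → t i j ≡ false
      disjoint′ j u v e with t i j in e′
      ... | false = refl
      ... | true  = ⊥-elim (true≢false e (disjoint j u v e′))

      -- At the end of the upper row, B and C touch diagonally.
      leftAbove : ∀ q p → 1 ≤ q → p ≤ n → q ≤ p → t i q ≡ true → t (suc i) p ≡ true → ⊥
      leftAbove q p 1≤q p≤n q≤p eq ep
        with last-true (t i) q≤p eq (disjoint′ p (≤-trans 1≤q q≤p) p≤n ep)
      ... | z , q≤z , z<p , ez , ez′
        with complement-false X _ _ (disjoint z (≤-trans 1≤q q≤z) (≤-trans (<⇒≤ z<p) p≤n) ez) | complement-false X _ _ ez′
      ... | Y , x | Z , w = clash Y Z x w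
        where
        1≤z = ≤-trans 1≤q q≤z
        z≤n′ = ≤-trans (<⇒≤ z<p) p≤n
        1+z≤n = ≤-trans z<p p≤n
        -- Every other region reaches a cell of `T`: `A` spreads up to `(i , z)`, while `B` and `D`
        -- spread right to `(suc i , p)`.
        lower : ∀ Y → X (Y , suc i , z) ≡ true → Y ≡ C
        lower A x = contradiction (rowClosed A (n≤1+n i) (s≤s z≤n) i<m i≤m 1≤z z≤n′ x) (free A ez)
        lower B x = contradiction (colClosed B (<⇒≤ z<p) 1≤z z≤n′ p≤n (s≤s z≤n) i<m x) (free B ep)
        lower C x = refl
        lower D x = contradiction (colClosed D (<⇒≤ z<p) 1≤z z≤n′ p≤n (s≤s z≤n) i<m x) (free D ep)
        -- `A` and `C` spread left to `(i , z)`; `D` spreads right to column `p` and then down to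
        -- `(suc i , p)`.
        upper : ∀ Z → X (Z , i , suc z) ≡ true → Z ≡ B
        upper A x = contradiction (colClosed A (n≤1+n z) (s≤s z≤n) 1+z≤n z≤n′ 1≤i i≤m x) (free A ez)
        upper B x = refl
        upper C x = contradiction (colClosed C (n≤1+n z) (s≤s z≤n) 1+z≤n z≤n′ 1≤i i≤m x) (free C ez)
        upper D x = contradiction
          (rowClosed D (n≤1+n i) 1≤i i≤m i<m (≤-trans 1≤q q≤p) p≤n
            (colClosed D z<p (s≤s z≤n) 1+z≤n p≤n 1≤i i≤m x)) (free D ep)
        clash : ∀ Y Z → X (Y , suc i , z) ≡ true → X (Z , i , suc z) ≡ true → ⊥
        clash Y Z x w with lower Y x | upper Z w
        ... | refl | refl =
          let _ , _ , (_ , h , _) , _ = cells i 1≤i i≤m (suc z) (s≤s z≤n) 1+z≤n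
          in  true≢false x (subst (λ y → X (C , y , z) ≡ false) (+-comm i 1) (h w))

      -- At the end of the lower row, A and D touch diagonally.
      leftBelow : ∀ p q → 1 ≤ p → q ≤ n → p ≤ q → t (suc i) p ≡ true → t i q ≡ true → ⊥
      leftBelow p q 1≤p q≤n p≤q ep eq
        with last-true (t (suc i)) p≤q ep (disjoint q (≤-trans 1≤p p≤q) q≤n eq)
      ... | z , p≤z , z<q , ez , ez′
        with complement-false X _ _ (disjoint′ z (≤-trans 1≤p p≤z) (≤-trans (<⇒≤ z<q) q≤n) ez) | complement-false X _ _ ez′
      ... | Y , x | Z , w = clash Y Z x w
        where
        1≤z = ≤-trans 1≤p p≤z
        z≤n′ = ≤-trans (<⇒≤ z<q) q≤n
        1+z≤n = ≤-trans z<q q≤n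
        -- `B` and `D` would spread right to `(i , q)`, and `C` down to `(suc i , z)`.
        upper : ∀ Y → X (Y , i , z) ≡ true → Y ≡ A
        upper A x = refl
        upper B x = contradiction (colClosed B (<⇒≤ z<q) 1≤z z≤n′ q≤n 1≤i i≤m x) (free B eq)
        upper C x = contradiction (rowClosed C (n≤1+n i) 1≤i i≤m i<m 1≤z z≤n′ x) (free C ez)
        upper D x = contradiction (colClosed D (<⇒≤ z<q) 1≤z z≤n′ q≤n 1≤i i≤m x) (free D eq)
        -- `A` and `C` spread left to `(suc i , z)`; `B` spreads right to column `q` and then up to
        -- `(i , q)`.
        lower : ∀ Z → X (Z , suc i , suc z) ≡ true → Z ≡ D
        lower A x = contradiction (colClosed A (n≤1+n z) (s≤s z≤n) 1+z≤n z≤n′ (s≤s z≤n) i<m x) (free A ez)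
        lower B x = contradiction
          (rowClosed B (n≤1+n i) (s≤s z≤n) i<m i≤m (≤-trans 1≤p p≤q) q≤n
            (colClosed B z<q (s≤s z≤n) 1+z≤n q≤n (s≤s z≤n) i<m x)) (free B eq)
        lower C x = contradiction (colClosed C (n≤1+n z) (s≤s z≤n) 1+z≤n z≤n′ (s≤s z≤n) i<m x) (free C ez)
        lower D x = refl
        clash : ∀ Y Z → X (Y , i , z) ≡ true → X (Z , suc i , suc z) ≡ true → ⊥
        clash Y Z x w with upper Y x | lower Z w
        ... | refl | refl =
          let _ , _ , (h , _) , _ = cells i 1≤i i≤m z 1≤z z≤n′
          in  true≢false w (subst₂ (λ y y′ → X (D , y , y′) ≡ false) (+-comm i 1) (+-comm z 1) (h x))

    -- Both rows are inhabited. Were they disjoint, a cell of one would lie to the left of a cell of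
    -- the other, and both orders are impossible.
    rowsMeet : ∀ i i′ → toℕ i′ ≡ suc (toℕ i) → ∃ λ j → T i j ≡ true × T i′ j ≡ true
    rowsMeet i i′ eq with find (λ j → if T i j then T i′ j else false)
    ... | inj₁ (j , e) with T i j in e₁
    ...   | true = j , e₁ , e
    rowsMeet i i′ eq | inj₂ h = ⊥-elim (absurd (≤-total (toℕ q) (toℕ p)))
      where
      q = proj₁ (rowInhabited i)
      p = proj₁ (rowInhabited i′)
      i⁺<m : suc (position i) ≤ m
      i⁺<m = subst (_< m) eq (toℕ<n i′)
      ep : t (suc (position i)) (position p) ≡ true
      ep = subst (λ x → t (suc x) (position p) ≡ true) eq (proj₂ (rowInhabited i′))
      disjointFin : ∀ j → T i j ≡ true → t (suc (position i)) (position j) ≡ false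
      disjointFin j e = subst (λ x → t (suc x) (position j) ≡ false) eq
        (subst (λ b → (if b then T i′ j else false) ≡ false) e (h j))
      disjoint : ∀ j → 1 ≤ j → j ≤ n → t (position i) j ≡ true → t (suc (position i)) j ≡ false
      disjoint j u v e with isPosition u v
      ... | at j′ = disjointFin j′ e
      absurd : toℕ q ≤ toℕ p ⊎ toℕ p ≤ toℕ q → ⊥
      absurd (inj₁ le) = leftAbove (1≤position i) i⁺<m disjoint (position q) (position p)
        (1≤position q) (position≤n p) (s≤s le) (proj₂ (rowInhabited i)) ep
      absurd (inj₂ le) = leftBelow (1≤position i) i⁺<m disjoint (position p) (position q)
        (1≤position p) (position≤n q) (s≤s le) ep (proj₂ (rowInhabited i))

    solution : IsSolution r c T
    solution = (RowChain.isPolyomino T hconvex rowsMeet , hconvex , vconvex) , realization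

-- Assignments completed outside the grid

inGrid? : ∀ m n i j → Dec (InGrid m n i j)
inGrid? m n i j = (1 ≤? i ×-dec i ≤? m) ×-dec (1 ≤? j ×-dec j ≤? n)

extend : ℕ → ℕ → Assignment → Assignment
extend m n α (Y , i , j) = if does (inGrid? m n i j) then α (Y , i , j) else true

extend-inside : ∀ m n α Y i j → InGrid m n i j → extend m n α (Y , i , j) ≡ α (Y , i , j)
extend-inside m n α Y i j g rewrite dec-true (inGrid? m n i j) g = refl

extend-outside : ∀ m n α → TrueOutside m n (extend m n α)
extend-outside m n α Y i j ¬g rewrite dec-false (inGrid? m n i j) ¬g = refl

-- Paths in polyominoes

preserved : ∀ {P : Set} {R : P → P → Set} (I : P → Set) → (∀ {p q} → R p q → I p → I q) →
  ∀ {p q} → Star R p q → I p → I q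
preserved I step ε        i = i
preserved I step (s ◅ ss) i = preserved I step ss (step s i)

adjacent-cases : ∀ {m n} (T : Object m n) {x x′ y y′ e e′} → Adjacent T ((x , y) , e) ((x′ , y′) , e′) →
  (y ≡ y′ × ∣ toℕ x - toℕ x′ ∣ ≤ 1) ⊎ (x ≡ x′ × ∣ toℕ y - toℕ y′ ∣ ≤ 1)
adjacent-cases T {x} {x′} {y} {y′} p with ∣ toℕ x - toℕ x′ ∣ in eq
... | zero  = inj₂ (toℕ-injective (∣m-n∣≡0⇒m≡n eq) , p)
... | suc d = inj₁ ( toℕ-injective (∣m-n∣≡0⇒m≡n (n≤0⇒n≡0 (m+n≤o⇒n≤o d (s≤s⁻¹ p))))
                   , ≤-trans (m≤m+n (suc d) _) p)

-- A polyomino does not fit into two diagonally opposite quadrants.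
separated : ∀ {m n} {T : Object m n} → IsPolyomino T →
  {P : Fin m → Set} {Q : Fin n → Set} → (∀ x → Dec (P x)) → (∀ y → Dec (Q y)) →
  (∀ x y → T x y ≡ true → ¬ (P x × Q y)) → (∀ x y → T x y ≡ true → ¬ (¬ P x × ¬ Q y)) →
  ∀ x y x′ y′ → T x y ≡ true → T x′ y′ ≡ true → P x → P x′
separated {T = T} connected {P} {Q} P? Q? h h′ x y x′ y′ e e′ p =
  preserved {R = Adjacent T} (λ c → P (proj₁ (proj₁ c))) (λ {c} {d} → step {c} {d}) (connected ((x , y) , e) ((x′ , y′) , e′)) p
  where
  step : ∀ {c d : Cell T} → Adjacent T c d → P (proj₁ (proj₁ c)) → P (proj₁ (proj₁ d))
  step {(a , b) , u} {(a′ , b′) , v} adj pa with adjacent-cases T {e = u} {e′ = v} adj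
  ... | inj₂ (refl , _) = pa
  ... | inj₁ (refl , _) with P? a′
  ...   | yes q = q
  ...   | no ¬q with Q? b
  ...     | yes q  = contradiction (pa , q) (h a b u)
  ...     | no ¬q′ = contradiction (¬q , ¬q′) (h′ a′ b v)

vconvex-along : ∀ {m n} {T : Object m n} d → VConvex T → ∀ {a i x b} →
  position a ≤[ d ] position i → position i ≤[ d ] position x →
  T a b ≡ true → T x b ≡ true → T i b ≡ true
vconvex-along fwd vconvex p q ab xb = vconvex _ _ _ _ (s≤s⁻¹ p) (s≤s⁻¹ q) ab xb
vconvex-along bwd vconvex p q ab xb = vconvex _ _ _ _ (s≤s⁻¹ q) (s≤s⁻¹ p) xb ab

-- If row i avoided the columns up to b, then the cells beyond row i in those columns
-- could not be left: by v-convexity, column b has no cell there.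
crossing : ∀ {m n} {T : Object m n} → IsPolyomino T → VConvex T → ∀ d e {a i k b q} →
  T a b ≡ true → T k q ≡ true → position a ≤[ d ] position i → position i ≤[ d ] position k →
  position q ≤[ e ] position b → ∃ λ j → T i j ≡ true × position j ≤[ e ] position b
crossing {T = T} connected vconvex d e {a} {i} {k} {b} {q} ab kq a≤i i≤k q≤b
  with any? (λ j → (T i j Bool.≟ true) ×-dec (position j ≤[ e ]? position b))
... | yes found = found
... | no ¬found = contradiction a≤i (proj₁
  (preserved {R = Adjacent T} Beyond (λ {c} {d} → step {c} {d}) (connected ((k , q) , kq) ((a , b) , ab)) start))
  where
  Beyond : Cell T → Set
  Beyond ((x , y) , _) = ¬ position x ≤[ d ] position i × position y ≤[ e ] position b
  start : Beyond ((k , q) , kq)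
  start = (λ k≤i → ¬found (q , subst (λ x → T x q ≡ true) (toℕ-injective (suc-injective (≤[]-antisym d k≤i i≤k))) kq , q≤b)) , q≤b
  step : ∀ {c c′ : Cell T} → Adjacent T c c′ → Beyond c → Beyond c′
  step {(x , y) , u} {(x′ , y′) , v} adj (x≰i , y≤b) with adjacent-cases T {e = u} {e′ = v} adj
  ... | inj₁ (refl , near) = (λ x′≤i → ¬found (y , subst (λ z → T z y ≡ true)
          (toℕ-injective (suc-injective (≤[]-step d near x≰i x′≤i))) v , y≤b)) , y≤b
  ... | inj₂ (refl , near) with position y′ ≤[ e ]? position b
  ...   | yes y′≤b = x≰i , y′≤b
  ...   | no  y′≰b with toℕ-injective (suc-injective (≤[]-step e {position y′} {position y}
          (subst (_≤ 1) (∣-∣-comm (toℕ y) (toℕ y′)) near) y′≰b y≤b))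
  ...     | refl = contradiction (b , vconvex-along d vconvex a≤i (≰[]⇒≥ d x≰i) ab u , ≤[]-refl e) ¬found

-- Solutions yield satisfying assignments

module Completeness {m n : ℕ} (r : Vector ℕ m) (c : Vector ℕ n)
  (rpos : ∀ i → 1 ≤ r i) (cpos : ∀ j → 1 ≤ c j) (T : Object m n) (solution : IsSolution r c T) where

  connected : IsPolyomino T
  connected = proj₁ (proj₁ solution)

  hconvex : HConvex T
  hconvex = proj₁ (proj₂ (proj₁ solution))

  vconvex : VConvex T
  vconvex = proj₂ (proj₂ (proj₁ solution))

  rowCell : ∀ i → ∃ λ j → T i j ≡ true
  rowCell i = count-positive (T i) (subst (1 ≤_) (sym (proj₁ (proj₂ solution) i)) (rpos i))

  colCell : ∀ j → ∃ λ i → T i j ≡ true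
  colCell j = count-positive (λ i → T i j) (subst (1 ≤_) (sym (proj₂ (proj₂ solution) j)) (cpos j))

  Hits : Var → Set
  Hits (Y , i , j) = ∃ λ x → ∃ λ y →
    T x y ≡ true × position x ≤[ rowDirection Y ] i × position y ≤[ colDirection Y ] j

  hits? : ∀ v → Dec (Hits v)
  hits? (Y , i , j) = any? λ x → any? λ y →
    (T x y Bool.≟ true) ×-dec ((position x ≤[ rowDirection Y ]? i) ×-dec (position y ≤[ colDirection Y ]? j))

  -- Each symbol claims the cells whose quadrant towards its corner contains no cell of T.
  α : Assignment
  α v = if does (hits? v) then false else true

  X : Assignment
  X = extend m n α

  -- The truth condition of `X`: outside the grid it holds vacuously, in line with the convention.
  Claimed : Symbol → ℕ → ℕ → Set
  Claimed Y i j = InGrid m n i j → ¬ Hits (Y , i , j)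

  claimed : ∀ Y {i j} → X (Y , i , j) ≡ true → Claimed Y i j
  claimed Y {i} {j} e g h rewrite extend-inside m n α Y i j g | dec-true (hits? (Y , i , j)) h =
    contradiction e λ ()

  claim : ∀ Y {i j} → Claimed Y i j → X (Y , i , j) ≡ true
  claim Y {i} {j} h with inGrid? m n i j
  ... | no ¬g = extend-outside m n α Y i j ¬g
  ... | yes g rewrite extend-inside m n α Y i j g | dec-false (hits? (Y , i , j)) (h g) = refl

  hit : ∀ Y {i j} → X (Y , i , j) ≡ false → Hits (Y , i , j)
  hit Y e = decidable-stable (hits? _) λ ¬h → true≢false (claim Y λ _ → ¬h) e

  unclaimed : ∀ Y {i j} → ¬ Claimed Y i j → X (Y , i , j) ≡ false
  unclaimed Y h = Bool.¬-not λ e → h (claimed Y e)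

  cell : (i : Fin m) (j : Fin n) → InGrid m n (position i) (position j)
  cell i j = (1≤position i , position≤n i) , (1≤position j , position≤n j)

  closed : ∀ Y {i j i′ j′} → InGrid m n i j → i′ ≤[ rowDirection Y ] i → j′ ≤[ colDirection Y ] j →
    X (Y , i , j) ≡ true → X (Y , i′ , j′) ≡ true
  closed Y g p q e = claim Y λ _ (x , y , t , u , v) →
    claimed Y e g (x , y , t , ≤[]-trans (rowDirection Y) u p , ≤[]-trans (colDirection Y) v q)

  -- Row `i` contains a cell of `T`, and quadrants on opposite sides of column `j` together cover
  -- that row, so they cannot both be empty. For regions on the same side, `colSplit` argues in the
  -- column.
  rowSplit : ∀ Y Z {i j} → (∀ y → y ≤[ colDirection Y ] position j ⊎ y ≤[ colDirection Z ] position j) →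
    X (Y , position i , position j) ≡ true → X (Z , position i , position j) ≡ false
  rowSplit Y Z {i} {j} sides e = unclaimed Z λ z → split z (sides (position y))
    where
    y = proj₁ (rowCell i)
    split : Claimed Z (position i) (position j) →
      position y ≤[ colDirection Y ] position j ⊎ position y ≤[ colDirection Z ] position j → ⊥
    split z (inj₁ p) = claimed Y e (cell i j) (i , y , proj₂ (rowCell i) , ≤[]-refl (rowDirection Y) , p)
    split z (inj₂ p) = z (cell i j) (i , y , proj₂ (rowCell i) , ≤[]-refl (rowDirection Z) , p)

  colSplit : ∀ Y Z {i j} → (∀ x → x ≤[ rowDirection Y ] position i ⊎ x ≤[ rowDirection Z ] position i) →
    X (Y , position i , position j) ≡ true → X (Z , position i , position j) ≡ false
  colSplit Y Z {i} {j} sides e = unclaimed Z λ z → split z (sides (position x))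
    where
    x = proj₁ (colCell j)
    split : Claimed Z (position i) (position j) →
      position x ≤[ rowDirection Y ] position i ⊎ position x ≤[ rowDirection Z ] position i → ⊥
    split z (inj₁ p) = claimed Y e (cell i j) (x , j , proj₂ (colCell j) , p , ≤[]-refl (colDirection Y))
    split z (inj₂ p) = z (cell i j) (x , j , proj₂ (colCell j) , p , ≤[]-refl (colDirection Z))

  up : ∀ {j} x → x ≤ j ⊎ j ≤ x
  up x = ≤-total x _

  down : ∀ {j} x → j ≤ x ⊎ x ≤ j
  down x = ≤-total _ x

  -- Con refers to variables outside the grid, which are true; these lemmas exclude that case.
  A-interior : ∀ i j → X (A , position i , position j) ≡ true → position i < m × position j < n
  A-interior i j e = ≰⇒> (λ m≤i → let x , t = colCell j in
      claimed A e (cell i j) (x , j , t , ≤-trans (position≤n x) m≤i , ≤-refl)) ,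
    ≰⇒> (λ n≤j → let y , t = rowCell i in
      claimed A e (cell i j) (i , y , t , ≤-refl , ≤-trans (position≤n y) n≤j))

  B-interior : ∀ i j → X (B , position i , position j) ≡ true → position i < m × 1 ≤ toℕ j
  B-interior i j e = ≰⇒> (λ m≤i → let x , t = colCell j in
      claimed B e (cell i j) (x , j , t , ≤-trans (position≤n x) m≤i , ≤-refl)) ,
    ≰⇒> (λ j≤0 → let y , t = rowCell i in
      claimed B e (cell i j) (i , y , t , ≤-refl , s≤s (≤-trans j≤0 z≤n)))

  rowBelow : ∀ {i : Fin m} → position i < m → ∃ λ i⁺ → toℕ i⁺ ≡ position i
  rowBelow p = fromℕ< p , toℕ-fromℕ< p

  -- If both regions held, `T` would be confined to the other two quadrants around the common corner
  -- of the two cells. These touch only diagonally, yet rows `i` and `i + 1` both contain cells.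
  con-A : ∀ i j → X (A , position i , position j) ≡ true → X (D , position i + 1 , position j + 1) ≡ false
  con-A i j e = unclaimed D absurd
    where
    interior = A-interior i j e
    i⁺ = proj₁ (rowBelow (proj₁ interior))
    i⁺≡ = proj₂ (rowBelow (proj₁ interior))
    absurd : ¬ Claimed D (position i + 1) (position j + 1)
    absurd z rewrite +-comm (toℕ i) 1 | +-comm (toℕ j) 1 = contradiction
      (separated connected {λ x → position x ≤ position i} {λ y → position y ≤ position j}
        (λ x → position x ≤? position i) (λ y → position y ≤? position j)
        (λ x y t (p , q) → claimed A e (cell i j) (x , y , t , p , q))
        (λ x y t (p , q) → z ((s≤s z≤n , proj₁ interior) , (s≤s z≤n , proj₂ interior)) (x , y , t , ≰⇒> p , ≰⇒> q))
        i _ i⁺ _ (proj₂ (rowCell i)) (proj₂ (rowCell i⁺)) ≤-refl)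
      (<⇒≱ (s≤s (≤-reflexive (sym i⁺≡))))

  con-B : ∀ i j → X (B , position i , position j) ≡ true → X (C , position i + 1 , position j ∸ 1) ≡ false
  con-B i j e = unclaimed C absurd
    where
    interior = B-interior i j e
    i⁺ = proj₁ (rowBelow (proj₁ interior))
    i⁺≡ = proj₂ (rowBelow (proj₁ interior))
    absurd : ¬ Claimed C (position i + 1) (position j ∸ 1)
    absurd z rewrite +-comm (toℕ i) 1 = contradiction
      (separated connected {λ x → position x ≤ position i} {λ y → position j ≤ position y}
        (λ x → position x ≤? position i) (λ y → position j ≤? position y)
        (λ x y t (p , q) → claimed B e (cell i j) (x , y , t , p , q))
        (λ x y t (p , q) → z ((s≤s z≤n , proj₁ interior) , (proj₂ interior , <⇒≤ (position≤n j))) (x , y , t , ≰⇒> p , s≤s⁻¹ (≰⇒> q)))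
        i _ i⁺ _ (proj₂ (rowCell i)) (proj₂ (rowCell i⁺)) ≤-refl)
      (<⇒≱ (s≤s (≤-reflexive (sym i⁺≡))))

  -- Otherwise all cells of the column lie strictly between rows `a` and `a + c_j`, which is room
  -- for fewer than `c_j`. LBC takes for `a` a row in `A` or `B`, the clauses on row `c_j` alone
  -- take 0.
  columnFits : ∀ Z → rowDirection Z ≡ bwd → ∀ a j → (∀ x → T x j ≡ true → a ≤ toℕ x) →
    X (Z , a + entry c (position j) , position j) ≡ false
  columnFits Z dir a j above = unclaimed Z absurd
    where
    absurd : ¬ Claimed Z (a + entry c (position j)) (position j)
    absurd z rewrite entry-position c j with c j in eq | cpos j
    ... | suc d | _ = contradiction
      (subst (_≤ d) (trans (proj₂ (proj₂ solution) j) eq) (count-diameter (λ x → T x j) d close)) 1+n≰n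
      where
      before : ∀ x → T x j ≡ true → position x < a + suc d
      before x t with a + suc d ≤? position x
      ... | no  p = ≰⇒> p
      ... | yes p = ⊥-elim (z ((≤-trans (s≤s z≤n) (m≤n+m (suc d) a) , ≤-trans p (position≤n x)) , (1≤position j , position≤n j))
                     (x , j , t , subst (position x ≤[_] a + suc d) (sym dir) p , ≤[]-refl (colDirection Z)))
      close : ∀ x x′ → T x j ≡ true → T x′ j ≡ true → toℕ x′ < toℕ x + d
      close x x′ t t′ = s≤s⁻¹ (≤-trans (before x′ t′)
        (≤-trans (+-monoˡ-≤ (suc d) (above x t)) (≤-reflexive (+-suc (toℕ x) d))))

  lbc-top : ∀ Y Z → rowDirection Y ≡ fwd → rowDirection Z ≡ bwd → ∀ i j →
    X (Y , position i , position j) ≡ true → X (Z , position i + entry c (position j) , position j) ≡ false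
  lbc-top Y Z dir dir′ i j e = columnFits Z dir′ (position i) j λ x t →
    s≤s⁻¹ (≰⇒> λ p → claimed Y e (cell i j)
      (x , j , t , subst (position x ≤[_] position i) (sym dir) p , ≤[]-refl (colDirection Y)))

  -- Moves a hit from the quadrant into row `i` itself. The anchor lies in the extreme column on the
  -- side of `Y`, so it is not beyond the column of the hit, as `crossing` requires.
  reach : ∀ Y {i j k q} → T k q ≡ true → (∀ y → position {n} q ≤[ colDirection Y ] position {n} y) →
    position i ≤[ rowDirection Y ] position k → Hits (Y , position i , j) →
    ∃ λ y → T i y ≡ true × position y ≤[ colDirection Y ] j
  reach Y anchor extreme i≤k (a , b , t , a≤i , b≤j) =
    let y , t′ , y≤b = crossing connected vconvex (rowDirection Y) (colDirection Y) t anchor a≤i i≤k (extreme b)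
    in  y , t′ , ≤[]-trans (colDirection Y) y≤b b≤j

  module Anchored (first last : Fin n) (first≤ : ∀ (y : Fin n) → toℕ first ≤ toℕ y)
    (≤last : ∀ (y : Fin n) → toℕ y ≤ toℕ last) (first≡ : position first ≡ 1) (last≡ : position last ≡ n) where

    k l : Fin m
    k = proj₁ (colCell first)
    l = proj₁ (colCell last)

    open Constraints m n (entry r) (entry c) (position k) (position l) X

    -- If `Z` failed too, row `i` would have a cell in a column up to `j` and one in a column from
    -- `j + r i` on; h-convexity would fill in `r i + 1` cells. If `j + r i` is outside the grid,
    -- `Z` holds by convention.
    ubr-row : ∀ Y Z → colDirection Y ≡ fwd → colDirection Z ≡ bwd → ∀ (i : Fin m) (j : Fin n) →
      position i ≤[ rowDirection Y ] position k → position i ≤[ rowDirection Z ] position l →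
      (Y , position i , position j) ¬⟹ (Z , position i , position j + entry r (position i))
    ubr-row Y Z dir dir′ i j i≤k i≤l e rewrite entry-position r i = claim Z absurd
      where
      absurd : Claimed Z (position i) (position j + r i)
      absurd (_ , _ , fits) h
        with reach Y (proj₂ (colCell first)) (λ y → subst (position first ≤[_] position y) (sym dir) (s≤s (first≤ y))) i≤k (hit Y e)
           | reach Z (proj₂ (colCell last)) (λ y → subst (position last ≤[_] position y) (sym dir′) (s≤s (≤last y))) i≤l h
      ... | y , t , y≤j | y′ , t′ , j+r≤y′ = contradiction
        (subst (suc (r i) ≤_) (proj₁ (proj₂ solution) i)
          (count-interval (T i) (toℕ j) (suc (r i)) (≤-trans (≤-reflexive (+-suc (toℕ j) (r i))) fits)
            λ x p q → hconvex i y x y′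
              (≤-trans (s≤s⁻¹ (subst (position y ≤[_] position j) dir y≤j)) p)
              (≤-trans (s≤s⁻¹ (≤-trans q (≤-reflexive (+-suc (toℕ j) (r i)))))
                (s≤s⁻¹ (subst (position y′ ≤[_] position j + r i) dir′ j+r≤y′)))
              t t′))
        1+n≰n

    cells : ∀ i j → CellConstraint (position i) (position j)
    cells i j =
      ( closed A g (m∸n≤m (position i) 1) ≤-refl , closed A g ≤-refl (m∸n≤m (position j) 1)
      , closed B g (m∸n≤m (position i) 1) ≤-refl , closed B g ≤-refl (m≤m+n (position j) 1)
      , closed C g (m≤m+n (position i) 1) ≤-refl , closed C g ≤-refl (m∸n≤m (position j) 1)
      , closed D g (m≤m+n (position i) 1) ≤-refl , closed D g ≤-refl (m≤m+n (position j) 1) , tt) ,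
      ( rowSplit A B {i} {j} up , colSplit A C {i} {j} up , rowSplit A D {i} {j} up
      , rowSplit B A {i} {j} down , rowSplit B C {i} {j} down , colSplit B D {i} {j} up
      , colSplit C A {i} {j} down , rowSplit C B {i} {j} up , rowSplit C D {i} {j} up
      , rowSplit D A {i} {j} down , colSplit D B {i} {j} down , rowSplit D C {i} {j} down , tt) ,
      (con-A i j , con-B i j , tt) ,
      (lbc-top A C refl refl i j , lbc-top A D refl refl i j , lbc-top B C refl refl i j , lbc-top B D refl refl i j , tt) ,
      ( ubr-row A B refl refl i j , ubr-row C B refl refl i j
      , (λ p q → ubr-row A D refl refl i j q p) , ubr-row C D refl refl i j , tt)
      where
      g : InGrid m n (position i) (position j)
      g = cell i j

    occupied : ∀ Y {i j} → T i j ≡ true → X (Y , position i , position j) ≡ false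
    occupied Y {i} {j} t = unclaimed Y λ z →
      z (cell i j) (i , j , t , ≤[]-refl (rowDirection Y) , ≤[]-refl (colDirection Y))

    anc : Anc
    anc = atFirst A , atFirst B , atFirst C , atFirst D , atLast A , atLast B , atLast C , atLast D , tt
      where
      atFirst : ∀ Y → X (Y , position k , 1) ≡ false
      atFirst Y = subst (λ z → X (Y , position k , z) ≡ false) first≡ (occupied Y (proj₂ (colCell first)))
      atLast : ∀ Y → X (Y , position l , n) ≡ false
      atLast Y = subst (λ z → X (Y , position l , z) ≡ false) last≡ (occupied Y (proj₂ (colCell last)))

    allConstraints : AllConstraints
    allConstraints = grid , columns , anc
      where
      grid : ∀ i → 1 ≤ i → i ≤ m → ∀ j → 1 ≤ j → j ≤ n → CellConstraint i j
      grid i u v j u′ v′ with isPosition u v | isPosition u′ v′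
      ... | at i′ | at j′ = cells i′ j′
      columns : ∀ j → 1 ≤ j → j ≤ n → Lbc₀ j
      columns j u v with isPosition u v
      ... | at j′ = columnFits C refl 0 j′ (λ _ _ → z≤n) , columnFits D refl 0 j′ (λ _ _ → z≤n) , tt

satisfiable : ∀ {m n} (r : Vector ℕ m) (c : Vector ℕ n) → 1 ≤ n → (∀ i → 1 ≤ r i) → (∀ j → 1 ≤ c j) →
  ∃ (IsSolution r c) → ∃ λ k → ∃ λ l → (1 ≤ k × k ≤ m) × (1 ≤ l × l ≤ m) ×
  ∃ λ α → Constraints.AllConstraints m n (entry r) (entry c) k l (extend m n α)
satisfiable {m} {suc n} r c 1≤n rpos cpos (T , solution) =
  position k , position l , (1≤position k , position≤n k) , (1≤position l , position≤n l) , α , allConstraints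
  where
  open Completeness r c rpos cpos T solution
  ≤last : ∀ (y : Fin (suc n)) → toℕ y ≤ toℕ (fromℕ n)
  ≤last y = ≤-trans (s≤s⁻¹ (toℕ<n y)) (≤-reflexive (sym (toℕ-fromℕ n)))
  open Anchored zero (fromℕ n) (λ _ → z≤n) ≤last refl (cong suc (toℕ-fromℕ n))

-- A program logic with time bounds

-- Halting skips the rest of the program, so postconditions come in two parts: `Q` for states in
-- which execution goes on, `Φ` for final outcomes.
data Result (Q : State → Set) (Φ : Outcome → Set) : Outcome → Set where
  continues : ∀ {s} → Q s → Result Q Φ (running s)
  succeeds  : ∀ {T} → Φ (success T) → Result Q Φ (success T)
  fails     : Φ failure → Result Q Φ failure

After : ℕ → (State → Set) → (Outcome → Set) → Timed Outcome → Set
After t Q Φ x = proj₁ x ≤ t × Result Q Φ (proj₂ x)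

after-weaken : ∀ {t u Q R Φ x} → t ≤ u → (∀ s → Q s → R s) → After t Q Φ x → After u R Φ x
after-weaken t≤u Q⊆R (p , continues q) = ≤-trans p t≤u , continues (Q⊆R _ q)
after-weaken t≤u Q⊆R (p , succeeds φ)  = ≤-trans p t≤u , succeeds φ
after-weaken t≤u Q⊆R (p , fails φ)     = ≤-trans p t≤u , fails φ

after-outcome : ∀ {t Q Φ Ψ x} → (∀ o → Φ o → Ψ o) → After t Q Φ x → After t Q Ψ x
after-outcome Φ⊆Ψ (p , continues q) = p , continues q
after-outcome Φ⊆Ψ (p , succeeds φ)  = p , succeeds (Φ⊆Ψ _ φ)
after-outcome Φ⊆Ψ (p , fails φ)     = p , fails (Φ⊆Ψ _ φ)

after-▹ : ∀ u {t Q Φ x} → After t Q Φ x → After (u + t) Q Φ (u ▹ x)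
after-▹ u (p , q) = +-monoʳ-≤ u p , q

after-andThen : ∀ {t u Q R Φ x f} → After t Q Φ x → (∀ s → Q s → After u R Φ (f s)) →
  After (t + u) R Φ (andThen x f)
after-andThen (p , continues {s} q) h with h s q
... | p′ , q′ = +-mono-≤ p p′ , q′
after-andThen (p , succeeds φ) h = ≤-trans p (m≤m+n _ _) , succeeds φ
after-andThen (p , fails φ)    h = ≤-trans p (m≤m+n _ _) , fails φ

after-iterate : ∀ {t Φ f} (Inv : ℕ → State → Set) N i →
  (∀ x → i ≤ x → x < i + N → ∀ s → Inv x s → After t (Inv (suc x)) Φ (f x s)) →
  ∀ s → Inv i s → After (N * suc t) (Inv (i + N)) Φ (iterate N i f s)
after-iterate Inv zero    i body s inv = z≤n , continues (subst (λ x → Inv x s) (sym (+-identityʳ i)) inv)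
after-iterate {t} {Φ} {f} Inv (suc N) i body s inv =
  after-▹ 1 (after-andThen (body i ≤-refl (m<m+n i (s≤s z≤n)) s inv) λ s′ inv′ →
    subst (λ y → After (N * suc t) (Inv y) Φ (iterate N (suc i) f s′)) (sym (+-suc i N))
      (after-iterate Inv N (suc i)
        (λ x p q → body x (<⇒≤ p) (subst (x <_) (sym (+-suc i N)) q)) s′ inv′))

if-dec : ∀ {P X : Set} (d : Dec P) {a b : X} (Q : X → Set) → (P → Q a) → (¬ P → Q b) →
  Q (if does d then a else b)
if-dec (yes p) Q h h′ = h p
if-dec (no ¬p) Q h h′ = h′ ¬p

module _ (S : Solver) where
  open Solver S

  -- The 2 pays for the instruction and its lower bound `# 1`. The invariant is indexed by the next
  -- value of the register, hence ends at `suc h`.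
  after-for : ∀ {t Φ s h} (Inv : ℕ → State → Set) e (c : ℕ → Cmd ℕ) → value s e ≡ h →
    (∀ x → 1 ≤ x → x ≤ h → ∀ s → Inv x s → After t (Inv (suc x)) Φ (run S (c x) s)) →
    Inv 1 s → After (2 + cost e + h * suc t) (Inv (suc h)) Φ (run S (for (# 1) e c) s)
  after-for {s = s} Inv e c refl body inv = after-▹ (2 + cost e)
    (after-iterate Inv (value s e) 1 (λ x p q → body x p (s≤s⁻¹ q)) s inv)

  after-if : ∀ {t Q Φ s} e f c d → (value s e ≤ value s f → After t Q Φ (run S c s)) →
    (¬ value s e ≤ value s f → After t Q Φ (run S d s)) →
    After (1 + cost e + cost f + t) Q Φ (run S (if e ≤′ f then c else d) s)
  after-if {t} {Q} {Φ} {s} e f c d h h′ =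
    after-▹ (1 + cost e + cost f) (if-dec (value s e ≤? value s f) (After t Q Φ) h h′)

  after-ifSat : ∀ {t u Q Φ s} e f c d → time (value s e) (value s f) (State.buffer s) ≤ u →
    (∀ α → solve (value s e) (value s f) (State.buffer s) ≡ just α →
      After t Q Φ (run S c (record s { assignment = α }))) →
    (solve (value s e) (value s f) (State.buffer s) ≡ nothing → After t Q Φ (run S d s)) →
    After (1 + cost e + cost f + u + t) Q Φ (run S (ifSat e f c d) s)
  after-ifSat {s = s} e f c d time≤ found none
    with solve (value s e) (value s f) (State.buffer s)
  ... | just α  with found α refl
  ...   | p , q = +-mono-≤ (+-monoʳ-≤ (1 + cost e + cost f) time≤) p , q
  after-ifSat {s = s} e f c d time≤ found none | nothing with none refl
  ...   | p , q = +-mono-≤ (+-monoʳ-≤ (1 + cost e + cost f) time≤) p , q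

-- An upper bound for the running time of commands without loops and 2SAT calls
-- (the value for the latter is junk).
straightCost : Cmd ℕ → ℕ
straightCost (c ⨾ d)                  = straightCost c + straightCost d
straightCost (if e ≤′ f then c else d) = 1 + cost e + cost f + (straightCost c + straightCost d)
straightCost (emit x)                 = 1 + costᶜ x
straightCost _                        = 1

cellCommand : (mE nE : Exp ℕ) (r c : Array) (k l i j : Exp ℕ) → Cmd ℕ
cellCommand mE nE r c k l i j = cor i j ⨾ dis i j ⨾ con i j ⨾ lbc c i j ⨾ ubr r k l i j
  where open Build mE nE

-- A register and a constant both cost 1, so `# 0` can stand for every loop register and the costs
-- do not depend on the indices.
cellCost columnCost anchorCost : (mE nE : Exp ℕ) (r c : Array) → ℕ
cellCost mE nE r c = straightCost (cellCommand mE nE r c (# 0) (# 0) (# 0) (# 0))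
columnCost mE nE r c = straightCost (Build.lbc₀ mE nE c (# 0))
anchorCost mE nE r c = straightCost (Build.anc mE nE (# 0) (# 0))

buildTime : (mE nE : Exp ℕ) (r c : Array) (m n : ℕ) → ℕ
buildTime mE nE r c m n =
  (2 + cost mE + m * suc (2 + cost nE + n * suc (cellCost mE nE r c))) +
  ((2 + cost nE + n * suc (columnCost mE nE r c)) + anchorCost mE nE r c)

-- A cell costs 19: four tests at 4 steps each and one write at 3.
writeTime : (mE nE : Exp ℕ) (m n : ℕ) → ℕ
writeTime mE nE m n = 2 + cost mE + m * suc (2 + cost nE + n * suc 19)

-- Expressions read only the dimensions and the input arrays, so their values survive all changes of
-- buffer, assignment and output.
value-frame : ∀ s s′ → State.rows s ≡ State.rows s′ → State.cols s ≡ State.cols s′ →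
  State.array s ≡ State.array s′ → ∀ e → value s e ≡ value s′ e
value-frame s s′ p q refl (` x)     = refl
value-frame s s′ p q refl (# k)     = refl
value-frame s s′ p q refl #rows     = p
value-frame s s′ p q refl #cols     = q
value-frame s s′ p q refl (a [ e ]) = cong (State.array s a) (value-frame s s′ p q refl e)
value-frame s s′ p q refl (e ⊕ f)   = cong₂ _+_ (value-frame s s′ p q refl e) (value-frame s s′ p q refl f)
value-frame s s′ p q refl (e ⊖ f)   = cong₂ _∸_ (value-frame s s′ p q refl e) (value-frame s s′ p q refl f)

-- Building the formula

module Building (S : Solver) (s₀ : State) (mE nE : Exp ℕ) where

  open Build mE nE

  m n : ℕ
  m = value s₀ mE
  n = value s₀ nE

  state : Formula → State
  state F = record s₀ { buffer = F }

  value-state : ∀ F e → value (state F) e ≡ value s₀ e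
  value-state F = value-frame (state F) s₀ refl refl refl

  valueˡ-state : ∀ F x → valueˡ (state F) x ≡ valueˡ s₀ x
  valueˡ-state F (pos (X , e , f)) = cong₂ (λ i j → pos (X , i , j)) (value-state F e) (value-state F f)
  valueˡ-state F (neg (X , e , f)) = cong₂ (λ i j → neg (X , i , j)) (value-state F e) (value-state F f)

  valueᶜ-state : ∀ F x → valueᶜ (state F) x ≡ valueᶜ s₀ x
  valueᶜ-state F ∅        = refl
  valueᶜ-state F (unit x) = cong unit (valueˡ-state F x)
  valueᶜ-state F (x ∨ y)  = cong₂ _∨_ (valueˡ-state F x) (valueˡ-state F y)

  -- `short` limits the input of the solver, and `overGrid` is the condition under which the
  -- solver's guarantees hold. `meaning` refers to the completed assignment because literals outside
  -- the grid are resolved before emission.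
  record Buffered (F : Formula) (t : ℕ) (P : Assignment → Set) (s : State) : Set where
    constructor buffered
    field
      new      : Formula
      appended : s ≡ state (new ++ F)
      short    : length new ≤ t
      overGrid : OverGrid m n new
      meaning  : ∀ α → (α ⊨ new) ⇔ P (extend m n α)

  -- One `t` bounds both the time and the number of new clauses. Quantifying over the old buffer `F`
  -- makes commands composable, and `⊥` records that building never halts the program.
  record BuildsIn (t : ℕ) (c : Cmd ℕ) (P : Assignment → Set) : Set where
    constructor builds
    field
      after : ∀ F → After t (Buffered F t P) (λ _ → ⊥) (run S c (state F))

  open BuildsIn

  Builds : Cmd ℕ → (Assignment → Set) → Set
  Builds c = BuildsIn (straightCost c) c

  open Equivalence

  buffered-resp : ∀ {F t u P Q} → t ≤ u → (∀ α → P (extend m n α) ⇔ Q (extend m n α)) →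
    ∀ s → Buffered F t P s → Buffered F u Q s
  buffered-resp t≤u P⇔Q s (buffered new eq len grid spec) = buffered new eq (≤-trans len t≤u) grid λ α →
    mk⇔ (λ h → to (P⇔Q α) (to (spec α) h)) (λ h → from (spec α) (from (P⇔Q α) h))

  builds-resp : ∀ {t u c P Q} → t ≤ u → (∀ α → P (extend m n α) ⇔ Q (extend m n α)) →
    BuildsIn t c P → BuildsIn u c Q
  builds-resp t≤u P⇔Q (builds h) = builds λ F → after-weaken t≤u (buffered-resp t≤u P⇔Q) (h F)

  buffered-trans : ∀ {F t u P Q s} (b : Buffered F t P s) →
    ∀ s′ → Buffered (Buffered.new b ++ F) u Q s′ → Buffered F (t + u) (λ X → P X × Q X) s′
  buffered-trans {F} {t} {u} (buffered new _ len grid spec) s′ (buffered new′ refl len′ grid′ spec′) =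
    buffered (new′ ++ new) (cong state (sym (++-assoc new′ new F)))
      (≤-trans (≤-reflexive (length-++ new′)) (≤-trans (+-mono-≤ len′ len) (≤-reflexive (+-comm u t))))
      (All.++⁺ grid′ grid)
      λ α → mk⇔ (λ h → to (spec α) (All.++⁻ʳ new′ h) , to (spec′ α) (All.++⁻ˡ new′ h))
                (λ (p , q) → All.++⁺ (from (spec′ α) q) (from (spec α) p))

  infixr 3 _⨾ᵇ_
  _⨾ᵇ_ : ∀ {t u c d P Q} → BuildsIn t c P → BuildsIn u d Q → BuildsIn (t + u) (c ⨾ d) (λ X → P X × Q X)
  builds h ⨾ᵇ builds h′ = builds λ F → after-andThen (h F) λ { s b@(buffered new refl _ _ _) →
    after-weaken ≤-refl (buffered-trans b) (h′ (new ++ F)) }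

  builds-skip : ∀ {P} → (∀ α → P (extend m n α)) → Builds skip P
  builds-skip p = builds λ F → ≤-refl , continues (buffered [] refl z≤n [] λ α → mk⇔ (λ _ → p α) (λ _ → []))

  builds-emit : ∀ x {P} → OverGridᶜ m n (valueᶜ s₀ x) →
    (∀ α → (α ⊨ᶜ valueᶜ s₀ x) ⇔ P (extend m n α)) → Builds (emit x) P
  builds-emit x grid spec = builds λ F → ≤-refl , continues
    (buffered (valueᶜ s₀ x ∷ []) (cong (λ y → state (y ∷ F)) (valueᶜ-state F x)) (s≤s z≤n) (grid ∷ [])
      λ α → mk⇔ (λ { (h ∷ []) → to (spec α) h }) (λ h → from (spec α) h ∷ []))

  builds-if : ∀ e f {c d P} → (value s₀ e ≤ value s₀ f → Builds c P) →
    (¬ value s₀ e ≤ value s₀ f → Builds d P) → Builds (if e ≤′ f then c else d) P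
  builds-if e f {c} {d} h h′ = builds λ F → after-if S e f c d
    (λ p → widen (m≤m+n _ _) (after (h (subst₂ _≤_ (value-state F e) (value-state F f) p)) F))
    (λ ¬p → widen (m≤n+m _ _) (after (h′ λ p → ¬p (subst₂ _≤_ (sym (value-state F e)) (sym (value-state F f)) p)) F))
    where
    widen : ∀ {F t P x} → t ≤ straightCost c + straightCost d → After t (Buffered F t P) (λ _ → ⊥) x →
      After (straightCost c + straightCost d) (Buffered F (straightCost (if e ≤′ f then c else d)) P) (λ _ → ⊥) x
    widen le = after-weaken le (buffered-resp (≤-trans le (m≤n+m _ (1 + cost e + cost f))) λ α → mk⇔ (λ p → p) (λ p → p))

  builds-when : ∀ e f {c P} → Builds c P →
    Builds (if e ≤′ f then c else skip) (λ X → value s₀ e ≤ value s₀ f → P X)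
  builds-when e f h = builds-if e f
    (λ p → builds-resp ≤-refl (λ α → mk⇔ (λ q _ → q) (λ q → q p)) h)
    (λ ¬p → builds-skip λ α p → contradiction p ¬p)

  builds-for : ∀ {t} {c : ℕ → Cmd ℕ} {P : ℕ → Assignment → Set} e → (∀ i → BuildsIn t (c i) (P i)) →
    BuildsIn (2 + cost e + value s₀ e * suc t) (for (# 1) e c)
      (λ X → ∀ i → 1 ≤ i → i ≤ value s₀ e → P i X)
  builds-for {t} {c} {P} e body = builds λ F → after-weaken ≤-refl (finish F) (loop F)
    where
    Before : ℕ → Assignment → Set
    Before i X = ∀ x → 1 ≤ x → x < i → P x X
    -- The clause bound grows by `suc t` per pass, in step with the time of the loop.
    Inv : Formula → ℕ → State → Set
    Inv F i = Buffered F ((i ∸ 1) * suc t) (Before i)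
    snoc : ∀ i {X} → 1 ≤ i → (Before i X × P i X) ⇔ Before (suc i) X
    snoc i {X} 1≤i = mk⇔ (λ (h , h′) → below-suc {λ x → P x X} h h′)
      (λ h → (λ x p q → h x p (m≤n⇒m≤1+n q)) , h i 1≤i ≤-refl)
    grow : ∀ x → x * suc t + t ≤ suc x * suc t
    grow x = ≤-trans (+-monoʳ-≤ (x * suc t) (n≤1+n t)) (≤-reflexive (+-comm (x * suc t) (suc t)))
    step : ∀ F x → 1 ≤ x → x ≤ value s₀ e → ∀ s → Inv F x s →
      After t (Inv F (suc x)) (λ _ → ⊥) (run S (c x) s)
    step F (suc x) 1≤x x≤h s b@(buffered new refl _ _ _) = after-weaken ≤-refl
      (λ s′ b′ → buffered-resp {P = λ X → Before (suc x) X × P (suc x) X} {Q = Before (suc (suc x))}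
        (grow x) (λ α → snoc (suc x) {extend m n α} 1≤x) s′ (buffered-trans b s′ b′))
      (after (body (suc x)) (new ++ F))
    start : ∀ F → Inv F 1 (state F)
    start F = buffered [] refl z≤n [] λ α → mk⇔ (λ _ x p q → contradiction (≤-trans q p) 1+n≰n) (λ _ → [])
    loop : ∀ F → After (2 + cost e + value s₀ e * suc t) (Inv F (suc (value s₀ e))) (λ _ → ⊥)
      (run S (for (# 1) e c) (state F))
    loop F = after-for S (Inv F) e c (value-state F e) (step F) (start F)
    finish : ∀ F s → Inv F (suc (value s₀ e)) s →
      Buffered F (2 + cost e + value s₀ e * suc t) (λ X → ∀ i → 1 ≤ i → i ≤ value s₀ e → P i X) s
    finish F = buffered-resp {P = Before (suc (value s₀ e))} (m≤n+m _ (2 + cost e))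
      λ α → mk⇔ (λ h i p q → h i p (s≤s q)) (λ h i p q → h i p (s≤s⁻¹ q))

  builds-ifInGrid : ∀ v {c d P} → (let X , i , j = valueᵛ s₀ v) →
    (InGrid m n i j → Builds c P) → (¬ InGrid m n i j → Builds d P) → Builds (ifInGrid v c d) P
  builds-ifInGrid (_ , i , j) h h′ =
    builds-if (# 1) i
      (λ p → builds-if i mE
        (λ q → builds-if (# 1) j
          (λ r → builds-if j nE (λ s → h ((p , q) , (r , s))) λ ¬s → h′ λ g → ¬s (proj₂ (proj₂ g)))
          λ ¬r → h′ λ g → ¬r (proj₁ (proj₂ g)))
        λ ¬q → h′ λ g → ¬q (proj₂ (proj₁ g)))
      λ ¬p → h′ λ g → ¬p (proj₁ (proj₁ g))

  ⟦_⟧ : Literal (VarExp ℕ) → Literal Var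
  ⟦_⟧ = valueˡ s₀

  builds-cases : ∀ x {c t f P} → (OverGridˡ m n ⟦ x ⟧ → Builds c P) →
    ((∀ α → extend m n α ⊨ˡ ⟦ x ⟧) → Builds t P) →
    ((∀ α → ¬ extend m n α ⊨ˡ ⟦ x ⟧) → Builds f P) → Builds (cases x c t f) P
  builds-cases (pos v@(_ , _ , _)) h h⁺ h⁻ = builds-ifInGrid v h λ ¬g →
    h⁺ λ α → extend-outside m n α _ _ _ ¬g
  builds-cases (neg v@(_ , _ , _)) h h⁺ h⁻ = builds-ifInGrid v h λ ¬g →
    h⁻ λ α → true≢false (extend-outside m n α _ _ _ ¬g)

  ⊨ˡ-inside : ∀ x → OverGridˡ m n x → ∀ α → (α ⊨ˡ x) ⇔ (extend m n α ⊨ˡ x)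
  ⊨ˡ-inside (pos (Y , i , j)) g α = mk⇔ (trans (extend-inside m n α Y i j g)) (trans (sym (extend-inside m n α Y i j g)))
  ⊨ˡ-inside (neg (Y , i , j)) g α = mk⇔ (trans (extend-inside m n α Y i j g)) (trans (sym (extend-inside m n α Y i j g)))

  ⊨ˡ-~ : ∀ x X → (X ⊨ˡ ⟦ ~ x ⟧) ⇔ (¬ X ⊨ˡ ⟦ x ⟧)
  ⊨ˡ-~ (pos v) X = mk⇔ (λ e e′ → true≢false e′ e) Bool.¬-not
  ⊨ˡ-~ (neg v) X = mk⇔ true≢false Bool.¬-not

  ⊨ˡ? : ∀ X x → Dec (X ⊨ˡ x)
  ⊨ˡ? X (pos v) = X v Bool.≟ true
  ⊨ˡ? X (neg v) = X v Bool.≟ false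

  builds-require : ∀ x → Builds (require x) (λ X → X ⊨ˡ ⟦ x ⟧)
  builds-require x = builds-cases x
    (λ g → builds-emit (unit x) g (⊨ˡ-inside ⟦ x ⟧ g))
    builds-skip
    (λ h → builds-emit ∅ tt λ α → mk⇔ ⊥-elim (h α))

  -- A literal outside the grid has the same value under every completion. If it satisfies the
  -- implication, nothing is emitted; if it cannot help, only the other literal is required.
  builds-⇒ : ∀ x y → Builds (x ⇒ y) (λ X → X ⊨ˡ ⟦ x ⟧ → X ⊨ˡ ⟦ y ⟧)
  builds-⇒ x y = builds-cases (~ x)
    (λ g → builds-cases y
      (λ g′ → builds-emit ((~ x) ∨ y) (g , g′) λ α → mk⇔
        (λ { (inj₁ p) q → contradiction q (to (⊨ˡ-~ x _) (to (⊨ˡ-inside ⟦ ~ x ⟧ g α) p))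
           ; (inj₂ p) _ → to (⊨ˡ-inside ⟦ y ⟧ g′ α) p })
        (λ h → disjunction g g′ α h (⊨ˡ? (extend m n α) ⟦ x ⟧)))
      (λ h → builds-skip λ α _ → h α)
      (λ h → builds-emit (unit (~ x)) g λ α → mk⇔
        (λ p q → contradiction q (to (⊨ˡ-~ x _) (to (⊨ˡ-inside ⟦ ~ x ⟧ g α) p)))
        (λ i → from (⊨ˡ-inside ⟦ ~ x ⟧ g α) (from (⊨ˡ-~ x _) λ p → h α (i p)))))
    (λ h → builds-skip λ α p → contradiction p (to (⊨ˡ-~ x _) (h α)))
    (λ h → builds-resp ≤-refl
      (λ α → mk⇔ (λ q _ → q) (λ i → i (decidable-stable (⊨ˡ? _ ⟦ x ⟧) λ ¬p → h α (from (⊨ˡ-~ x _) ¬p))))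
      (builds-require y))
    where
    disjunction : OverGridˡ m n ⟦ ~ x ⟧ → OverGridˡ m n ⟦ y ⟧ → ∀ α →
      (extend m n α ⊨ˡ ⟦ x ⟧ → extend m n α ⊨ˡ ⟦ y ⟧) → Dec (extend m n α ⊨ˡ ⟦ x ⟧) →
      (α ⊨ˡ ⟦ ~ x ⟧) ⊎ (α ⊨ˡ ⟦ y ⟧)
    disjunction g g′ α h (yes p) = inj₂ (from (⊨ˡ-inside ⟦ y ⟧ g′ α) (h p))
    disjunction g g′ α h (no ¬p) = inj₁ (from (⊨ˡ-inside ⟦ ~ x ⟧ g α) (from (⊨ˡ-~ x _) ¬p))

  builds-end : Builds skip (λ _ → ⊤)
  builds-end = builds-skip λ _ → tt

  module _ (r c : Array) where

    ρ γ : ℕ → ℕ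
    ρ = State.array s₀ r
    γ = State.array s₀ c

    module _ (k l : ℕ) where

      open Constraints m n ρ γ k l

      builds-cell : ∀ i j → Builds (cellCommand mE nE r c (` k) (` l) (` i) (` j))
        (λ X → CellConstraint X i j)
      builds-cell i′ j′ = builds-cor ⨾ᵇ builds-dis ⨾ᵇ builds-con ⨾ᵇ builds-lbc ⨾ᵇ builds-ubr
        where
        i = ` i′
        j = ` j′
        builds-cor : Builds (cor i j) (λ X → Cor X i′ j′)
        builds-cor =
          builds-⇒ (A ⟨ i , j ⟩) (A ⟨ i ⊖ # 1 , j ⟩) ⨾ᵇ
          builds-⇒ (A ⟨ i , j ⟩) (A ⟨ i , j ⊖ # 1 ⟩) ⨾ᵇ
          builds-⇒ (B ⟨ i , j ⟩) (B ⟨ i ⊖ # 1 , j ⟩) ⨾ᵇ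
          builds-⇒ (B ⟨ i , j ⟩) (B ⟨ i , j ⊕ # 1 ⟩) ⨾ᵇ
          builds-⇒ (C ⟨ i , j ⟩) (C ⟨ i ⊕ # 1 , j ⟩) ⨾ᵇ
          builds-⇒ (C ⟨ i , j ⟩) (C ⟨ i , j ⊖ # 1 ⟩) ⨾ᵇ
          builds-⇒ (D ⟨ i , j ⟩) (D ⟨ i ⊕ # 1 , j ⟩) ⨾ᵇ
          builds-⇒ (D ⟨ i , j ⟩) (D ⟨ i , j ⊕ # 1 ⟩) ⨾ᵇ
          builds-end
        builds-dis : Builds (dis i j) (λ X → Dis X i′ j′)
        builds-dis =
          builds-⇒ (A ⟨ i , j ⟩) (~ B ⟨ i , j ⟩) ⨾ᵇ
          builds-⇒ (A ⟨ i , j ⟩) (~ C ⟨ i , j ⟩) ⨾ᵇ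
          builds-⇒ (A ⟨ i , j ⟩) (~ D ⟨ i , j ⟩) ⨾ᵇ
          builds-⇒ (B ⟨ i , j ⟩) (~ A ⟨ i , j ⟩) ⨾ᵇ
          builds-⇒ (B ⟨ i , j ⟩) (~ C ⟨ i , j ⟩) ⨾ᵇ
          builds-⇒ (B ⟨ i , j ⟩) (~ D ⟨ i , j ⟩) ⨾ᵇ
          builds-⇒ (C ⟨ i , j ⟩) (~ A ⟨ i , j ⟩) ⨾ᵇ
          builds-⇒ (C ⟨ i , j ⟩) (~ B ⟨ i , j ⟩) ⨾ᵇ
          builds-⇒ (C ⟨ i , j ⟩) (~ D ⟨ i , j ⟩) ⨾ᵇ
          builds-⇒ (D ⟨ i , j ⟩) (~ A ⟨ i , j ⟩) ⨾ᵇ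
          builds-⇒ (D ⟨ i , j ⟩) (~ B ⟨ i , j ⟩) ⨾ᵇ
          builds-⇒ (D ⟨ i , j ⟩) (~ C ⟨ i , j ⟩) ⨾ᵇ
          builds-end
        builds-con : Builds (con i j) (λ X → Con X i′ j′)
        builds-con =
          builds-⇒ (A ⟨ i , j ⟩) (~ D ⟨ i ⊕ # 1 , j ⊕ # 1 ⟩) ⨾ᵇ
          builds-⇒ (B ⟨ i , j ⟩) (~ C ⟨ i ⊕ # 1 , j ⊖ # 1 ⟩) ⨾ᵇ
          builds-end
        builds-lbc : Builds (lbc c i j) (λ X → Lbc X i′ j′)
        builds-lbc =
          builds-⇒ (A ⟨ i , j ⟩) (~ C ⟨ i ⊕ c [ j ] , j ⟩) ⨾ᵇ
          builds-⇒ (A ⟨ i , j ⟩) (~ D ⟨ i ⊕ c [ j ] , j ⟩) ⨾ᵇ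
          builds-⇒ (B ⟨ i , j ⟩) (~ C ⟨ i ⊕ c [ j ] , j ⟩) ⨾ᵇ
          builds-⇒ (B ⟨ i , j ⟩) (~ D ⟨ i ⊕ c [ j ] , j ⟩) ⨾ᵇ
          builds-end
        builds-ubr : Builds (ubr r (` k) (` l) i j) (λ X → Ubr X i′ j′)
        builds-ubr =
          builds-when _ _ (builds-when _ _ (builds-⇒ (~ A ⟨ i , j ⟩) (B ⟨ i , j ⊕ r [ i ] ⟩))) ⨾ᵇ
          builds-when _ _ (builds-when _ _ (builds-⇒ (~ C ⟨ i , j ⟩) (B ⟨ i , j ⊕ r [ i ] ⟩))) ⨾ᵇ
          builds-when _ _ (builds-when _ _ (builds-⇒ (~ A ⟨ i , j ⟩) (D ⟨ i , j ⊕ r [ i ] ⟩))) ⨾ᵇ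
          builds-when _ _ (builds-when _ _ (builds-⇒ (~ C ⟨ i , j ⟩) (D ⟨ i , j ⊕ r [ i ] ⟩))) ⨾ᵇ
          builds-end

      builds-lbc₀ : ∀ j → Builds (lbc₀ c (` j)) (λ X → Lbc₀ X j)
      builds-lbc₀ j =
        builds-require (~ C ⟨ c [ ` j ] , ` j ⟩) ⨾ᵇ builds-require (~ D ⟨ c [ ` j ] , ` j ⟩) ⨾ᵇ builds-end

      builds-anc : Builds (anc (` k) (` l)) Anc
      builds-anc =
        builds-require (~ A ⟨ ` k , # 1 ⟩) ⨾ᵇ
        builds-require (~ B ⟨ ` k , # 1 ⟩) ⨾ᵇ
        builds-require (~ C ⟨ ` k , # 1 ⟩) ⨾ᵇ
        builds-require (~ D ⟨ ` k , # 1 ⟩) ⨾ᵇ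
        builds-require (~ A ⟨ ` l , nE ⟩) ⨾ᵇ
        builds-require (~ B ⟨ ` l , nE ⟩) ⨾ᵇ
        builds-require (~ C ⟨ ` l , nE ⟩) ⨾ᵇ
        builds-require (~ D ⟨ ` l , nE ⟩) ⨾ᵇ
        builds-end

      -- `clear` discards what an earlier attempt has left, so the outcome is described relative to
      -- the empty buffer.
      build : ∀ F → After (1 + buildTime mE nE r c m n)
        (Buffered [] (buildTime mE nE r c m n) AllConstraints) (λ _ → ⊥)
        (run S (buildF r c (` k) (` l)) (state F))
      build F = after-▹ 1 (after constraints [])
        where
        constraints : BuildsIn (buildTime mE nE r c m n) _ AllConstraints
        constraints =
           builds-for mE (λ i → builds-for nE λ j → builds-cell i j) ⨾ᵇ
           builds-for nE builds-lbc₀ ⨾ᵇ builds-anc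

-- Writing the output

≡ᵇ-refl : ∀ x → (x ≡ᵇ x) ≡ true
≡ᵇ-refl zero    = refl
≡ᵇ-refl (suc x) = ≡ᵇ-refl x

update-hit : ∀ T i j b → update T i j b i j ≡ b
update-hit T i j b rewrite ≡ᵇ-refl i | ≡ᵇ-refl j = refl

update-miss : ∀ T i j b i′ j′ → ¬ (i ≡ i′ × j ≡ j′) → update T i j b i′ j′ ≡ T i′ j′
update-miss T i j b i′ j′ h with i ≡ᵇ i′ in p | j ≡ᵇ j′ in q
... | false | _     = refl
... | true  | false = refl
... | true  | true  = contradiction (≡ᵇ⇒≡ i i′ (subst Bool.T (sym p) tt) , ≡ᵇ⇒≡ j j′ (subst Bool.T (sym q) tt)) h

-- Serves both orientations of the search: `view` reads the output in the coordinates of the search,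
-- and `hits` and `misses` are the laws of an updated matrix.
record Writer (S : Solver) (put : Exp ℕ → Exp ℕ → Bool → Cmd ℕ) : Set where
  field
    view   : (ℕ → ℕ → Bool) → ℕ → ℕ → Bool
    next   : (ℕ → ℕ → Bool) → ℕ → ℕ → Bool → ℕ → ℕ → Bool
    runs   : ∀ i j b s → run S (put (` i) (` j) b) s ≡
               (3 , running (record s { output = next (State.output s) i j b }))
    hits   : ∀ o i j b → view (next o i j b) i j ≡ b
    misses : ∀ o i j b i′ j′ → ¬ (i ≡ i′ × j ≡ j′) → view (next o i j b) i′ j′ ≡ view o i′ j′

straightWriter : ∀ S → Writer S write
straightWriter S = record
  { view = λ o → o ; next = update ; runs = λ i j b s → refl ; hits = update-hit ; misses = update-miss }

transposedWriter : ∀ S → Writer S (λ i j → write j i)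
transposedWriter S = record
  { view   = λ o i j → o j i
  ; next   = λ o i j → update o j i
  ; runs   = λ i j b s → refl
  ; hits   = λ o i j → update-hit o j i
  ; misses = λ o i j b i′ j′ h → update-miss o j i b j′ i′ λ (p , q) → h (q , p)
  }

module Writing {S : Solver} {put : Exp ℕ → Exp ℕ → Bool → Cmd ℕ} (writer : Writer S put)
  (mE nE : Exp ℕ) (s₁ : State) where

  open Writer writer

  m n : ℕ
  m = value s₁ mE
  n = value s₁ nE

  α : Assignment
  α = State.assignment s₁

  writeCell : ℕ → ℕ → Cmd ℕ
  writeCell i j =
    ifTrue (A , ` i , ` j) (put (` i) (` j) false)
    (ifTrue (B , ` i , ` j) (put (` i) (` j) false)
    (ifTrue (C , ` i , ` j) (put (` i) (` j) false)
    (ifTrue (D , ` i , ` j) (put (` i) (` j) false)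
    (put (` i) (` j) true))))

  -- The cascade of tests branches exactly as `complement` does.
  run-writeCell : ∀ s i j → ∃ λ t → t ≤ 16 ×
    run S (writeCell i j) s ≡ (t ▹ run S (put (` i) (` j) (complement (State.assignment s) i j)) s)
  run-writeCell s i j with State.assignment s (A , i , j)
  ... | true = 4 , m≤m+n 4 12 , refl
  ... | false with State.assignment s (B , i , j)
  ...   | true = 8 , m≤m+n 8 8 , refl
  ...   | false with State.assignment s (C , i , j)
  ...     | true = 12 , m≤m+n 12 4 , refl
  ...     | false with State.assignment s (D , i , j)
  ...       | true  = 16 , ≤-refl , refl
  ...       | false = 16 , ≤-refl , refl

  Correct : (ℕ → ℕ → Bool) → ℕ → ℕ → Set
  Correct o i j = view o i j ≡ complement α i j

  RowsDone : ℕ → State → Set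
  RowsDone i s = ∃ λ o → s ≡ record s₁ { output = o } ×
    (∀ x → 1 ≤ x → x < i → ∀ y → 1 ≤ y → y ≤ n → Correct o x y)

  CellsDone : ℕ → ℕ → State → Set
  CellsDone i j s = ∃ λ o → s ≡ record s₁ { output = o } ×
    (∀ x → 1 ≤ x → x < i → ∀ y → 1 ≤ y → y ≤ n → Correct o x y) ×
    (∀ y → 1 ≤ y → y < j → Correct o i y)

  after-writeCell : ∀ {Φ} i j s → CellsDone i j s → After 19 (CellsDone i (suc j)) Φ (run S (writeCell i j) s)
  after-writeCell {Φ} i j _ (o , refl , rows , cells) =
    let t , t≤ , eq = run-writeCell (record s₁ { output = o }) i j in
    subst (After 19 (CellsDone i (suc j)) Φ)
      (sym (trans eq (cong (t ▹_) (runs i j (complement α i j) (record s₁ { output = o }))))) $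
    +-monoˡ-≤ 3 t≤ , continues (next o i j (complement α i j) , refl ,
      (λ x p q y u v → trans (misses o i j _ x y λ { (refl , _) → 1+n≰n q }) (rows x p q y u v)) ,
      below-suc {λ y → Correct (next o i j (complement α i j)) i y}
        (λ y p q → trans (misses o i j _ i y λ { (_ , refl) → 1+n≰n q }) (cells y p q))
        (hits o i j _))

  after-writeComplement : ∀ {Φ} → After (writeTime mE nE m n) (RowsDone (suc m)) Φ
    (run S (writeComplement mE nE put) s₁)
  after-writeComplement {Φ} = after-for S RowsDone mE (λ i → for (# 1) nE (writeCell i)) refl row
    (State.output s₁ , refl , λ x p q → contradiction (≤-trans q p) 1+n≰n)
    where
    row : ∀ i → 1 ≤ i → i ≤ m → ∀ s → RowsDone i s →
      After (2 + cost nE + n * suc 19) (RowsDone (suc i)) Φ (run S (for (# 1) nE (writeCell i)) s)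
    row i _ _ _ (o , refl , rows) = after-weaken ≤-refl
      (λ { s (o′ , refl , rows′ , cells′) → o′ , refl ,
           below-suc {λ x → ∀ y → 1 ≤ y → y ≤ n → Correct o′ x y} rows′ λ y p q → cells′ y p (s≤s q) })
      (after-for S (CellsDone i) nE (writeCell i) (value-frame (record s₁ { output = o }) s₁ refl refl refl nE)
        (λ j _ _ → after-writeCell i j)
        (o , refl , rows , λ y p q → contradiction (≤-trans q p) 1+n≰n))

-- The search

-- The linear bound of the solver with the number of clauses replaced by the building time that
-- dominates it.
solveTime : (slope overhead : ℕ) (mE nE : Exp ℕ) (r c : Array) (m n : ℕ) → ℕ
solveTime slope overhead mE nE r c m n = slope * (4 * (m * n) + buildTime mE nE r c m n) + overhead

attemptTime searchTime : (slope overhead : ℕ) (mE nE : Exp ℕ) (r c : Array) (m n : ℕ) → ℕ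
attemptTime slope overhead mE nE r c m n =
  (1 + buildTime mE nE r c m n) +
  (1 + cost mE + cost nE + solveTime slope overhead mE nE r c m n + (writeTime mE nE m n + 1))
searchTime slope overhead mE nE r c m n =
  (2 + cost mE + m * suc (2 + cost mE + m * suc (attemptTime slope overhead mE nE r c m n))) + 1

module Search (S : Solver) (linearTime : IsLinearTime2SAT S) (s₀ : State) (mE nE : Exp ℕ) (r c : Array)
  {put : Exp ℕ → Exp ℕ → Bool → Cmd ℕ} (writer : Writer S put) where

  open Solver S
  open IsLinearTime2SAT linearTime
  open Writer writer
  open Building S s₀ mE nE
  open Equivalence

  Satisfies : ℕ → ℕ → Assignment → Set
  Satisfies k l α = Constraints.AllConstraints m n (ρ r c) (γ r c) k l (extend m n α)

  Verdict : Outcome → Set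
  Verdict (running _) = ⊥
  Verdict (success o) = ∃ λ k → ∃ λ l → ∃ λ α → Satisfies k l α ×
    (∀ i j → InGrid m n i j → view o i j ≡ complement (extend m n α) i j)
  Verdict failure     = ∀ k → 1 ≤ k → k ≤ m → ∀ l → 1 ≤ l → l ≤ m → ¬ ∃ (Satisfies k l)

  -- A failed attempt changes nothing but the buffer: assignment and output are touched only on the
  -- way to `halt-output`.
  Reset : State → Set
  Reset s = ∃ λ F → s ≡ state F

  complement-extend : ∀ α i j → InGrid m n i j → complement α i j ≡ complement (extend m n α) i j
  complement-extend α i j g
    rewrite extend-inside m n α A i j g | extend-inside m n α B i j g
          | extend-inside m n α C i j g | extend-inside m n α D i j g = refl

  output : ∀ {k l α} F → Satisfies k l α → ∀ {Q} → After (writeTime mE nE m n + 1) Q Verdict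
    (run S (writeComplement mE nE put ⨾ halt-output) (record (state F) { assignment = α }))
  output {k} {l} {α} F sat {Q} = after-andThen {x = run S (writeComplement mE nE put) s₁} written finish
    where
    s₁ : State
    s₁ = record (state F) { assignment = α }
    module W = Writing writer mE nE s₁
    m≡ : W.m ≡ m
    m≡ = value-frame s₁ s₀ refl refl refl mE
    n≡ : W.n ≡ n
    n≡ = value-frame s₁ s₀ refl refl refl nE
    written : After (writeTime mE nE m n) (W.RowsDone (suc W.m)) Verdict (run S (writeComplement mE nE put) s₁)
    written = subst₂ (λ x y → After (writeTime mE nE x y) (W.RowsDone (suc W.m)) Verdict (run S (writeComplement mE nE put) s₁))
      m≡ n≡ W.after-writeComplement
    finish : ∀ s → W.RowsDone (suc W.m) s → After 1 Q Verdict (run S halt-output s)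
    finish _ (o , refl , done) = ≤-refl , succeeds (k , l , α , sat , λ i j g → trans
      (done i (proj₁ (proj₁ g)) (s≤s (≤-trans (proj₂ (proj₁ g)) (≤-reflexive (sym m≡))))
            j (proj₁ (proj₂ g)) (≤-trans (proj₂ (proj₂ g)) (≤-reflexive (sym n≡))))
      (complement-extend α i j g))

  attemptCommand : ℕ → ℕ → Cmd ℕ
  attemptCommand k l =
    Build.buildF mE nE r c (` k) (` l) ⨾
    ifSat mE nE (writeComplement mE nE put ⨾ halt-output) skip

  attempt : ∀ k l s → Reset s →
    After (attemptTime slope overhead mE nE r c m n) (λ s → Reset s × ¬ ∃ (Satisfies k l)) Verdict
      (run S (attemptCommand k l) s)
  attempt k l _ (F , refl) = after-andThen (after-outcome (λ _ ()) (build r c k l F)) test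
    where
    Next : State → Set
    Next s = Reset s × ¬ ∃ (Satisfies k l)
    call : ∀ new → length new ≤ buildTime mE nE r c m n → OverGrid m n new →
      (∀ α → (α ⊨ new) ⇔ Satisfies k l α) →
      After (1 + cost mE + cost nE + solveTime slope overhead mE nE r c m n + (writeTime mE nE m n + 1)) Next Verdict
        (run S (ifSat mE nE (writeComplement mE nE put ⨾ halt-output) skip) (state new))
    call new short grid spec = after-ifSat S mE nE _ skip
      (subst₂ (λ x y → time x y new ≤ solveTime slope overhead mE nE r c m n) (sym m≡) (sym n≡)
        (≤-trans (linear grid) (+-monoˡ-≤ overhead (*-monoʳ-≤ slope (+-monoʳ-≤ (4 * (m * n)) short)))))
      (λ α eq → output new (to (spec α) (sound grid (subst₂ (λ x y → solve x y new ≡ just α) m≡ n≡ eq))))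
      (λ eq → m≤n+m 1 (writeTime mE nE m n) , continues ((new , refl) , λ (α , sat) →
        complete grid (subst₂ (λ x y → solve x y new ≡ nothing) m≡ n≡ eq) (α , from (spec α) sat)))
      where
      m≡ = value-state new mE
      n≡ = value-state new nE
    test : ∀ s → Buffered [] (buildTime mE nE r c m n) (Constraints.AllConstraints m n (ρ r c) (γ r c) k l) s →
      After _ Next Verdict (run S (ifSat mE nE (writeComplement mE nE put ⨾ halt-output) skip) s)
    test _ (buffered new refl short grid spec) rewrite ++-identityʳ new = call new short grid spec

  after-search : ∀ {Q} → After (searchTime slope overhead mE nE r c m n) Q Verdict
    (run S (search mE nE r c put) s₀)
  after-search {Q} = after-andThen
    (after-for S Rows mE (λ k → for (# 1) mE (attemptCommand k)) refl row
      ((State.buffer s₀ , refl) , λ k p q → contradiction (≤-trans q p) 1+n≰n))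
    λ s (_ , none) → ≤-refl , fails λ k p q → none k p (s≤s q)
    where
    Rows : ℕ → State → Set
    Rows k s = Reset s × (∀ x → 1 ≤ x → x < k → ∀ l → 1 ≤ l → l ≤ m → ¬ ∃ (Satisfies x l))
    Cols : ℕ → ℕ → State → Set
    Cols k l s = Rows k s × (∀ y → 1 ≤ y → y < l → ¬ ∃ (Satisfies k y))
    row : ∀ k → 1 ≤ k → k ≤ m → ∀ s → Rows k s → After _ (Rows (suc k)) Verdict (run S (for (# 1) mE (attemptCommand k)) s)
    row k _ _ _ rows@((F , refl) , _) = after-weaken ≤-refl
      (λ s ((reset , before) , now) → reset ,
        below-suc {λ x → ∀ l → 1 ≤ l → l ≤ m → ¬ ∃ (Satisfies x l)} before λ l p q → now l p (s≤s q))
      (after-for S (Cols k) mE (attemptCommand k) (value-state F mE)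
        (λ l _ _ s ((reset , before) , now) → after-weaken ≤-refl
          (λ s′ (reset′ , ¬sat) → (reset′ , before) , below-suc {λ y → ¬ ∃ (Satisfies k y)} now ¬sat)
          (attempt k l s reset))
        (rows , λ y p q → contradiction (≤-trans q p) 1+n≰n))

-- Asymptotics

-- The bound holds for all positive dimensions, not just for large ones; additive constants are
-- absorbed because the bounds are `Positive`.
_∈O_ : (f g : ℕ → ℕ → ℕ) → Set
f ∈O g = ∃ λ K → ∀ m n → 1 ≤ m → 1 ≤ n → f m n ≤ K * g m n

Positive : (ℕ → ℕ → ℕ) → Set
Positive g = ∀ m n → 1 ≤ m → 1 ≤ n → 1 ≤ g m n

O-const : ∀ k {g} → Positive g → (λ _ _ → k) ∈O g
O-const k g≥1 = k , λ m n p q → ≤-trans (≤-reflexive (sym (*-identityʳ k))) (*-monoʳ-≤ k (g≥1 m n p q))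

O-self : ∀ g → g ∈O g
O-self g = 1 , λ m n _ _ → ≤-reflexive (sym (*-identityˡ (g m n)))

O-+ : ∀ {f f′ g} → f ∈O g → f′ ∈O g → (λ m n → f m n + f′ m n) ∈O g
O-+ {g = g} (K , h) (K′ , h′) = K + K′ , λ m n p q →
  ≤-trans (+-mono-≤ (h m n p q) (h′ m n p q)) (≤-reflexive (sym (*-distribʳ-+ (g m n) K K′)))

O-*ˡ : ∀ k {f g} → f ∈O g → (λ m n → k * f m n) ∈O g
O-*ˡ k {f} {g} (K , h) = k * K , λ m n p q →
  ≤-trans (*-monoʳ-≤ k (h m n p q)) (≤-reflexive (sym (*-assoc k K (g m n))))

O-trans : ∀ {f g h} → f ∈O g → g ∈O h → f ∈O h
O-trans {h = h} (K , p) (K′ , q) = K * K′ , λ m n u v →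
  ≤-trans (p m n u v) (≤-trans (*-monoʳ-≤ K (q m n u v)) (≤-reflexive (sym (*-assoc K K′ (h m n)))))

O-loop : ∀ (N : ℕ → ℕ → ℕ) {f g} → Positive g → f ∈O g → (λ m n → N m n * suc (f m n)) ∈O (λ m n → N m n * g m n)
O-loop N {f} {g} g≥1 fO with O-+ (O-const 1 g≥1) fO
... | K , h = K , λ m n p q → ≤-trans (*-monoʳ-≤ (N m n) (h m n p q))
  (≤-reflexive (trans (sym (*-assoc (N m n) K (g m n)))
    (trans (cong (_* g m n) (*-comm (N m n) K)) (*-assoc K (N m n) (g m n)))))

area : ℕ → ℕ → ℕ
area m n = m * n

area-positive : Positive area
area-positive m n p q = *-mono-≤ p q

cols∈O-area : (λ _ n → n) ∈O area
cols∈O-area = 1 , λ m n p q → ≤-trans (≤-reflexive (sym (*-identityˡ n)))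
  (≤-trans (*-monoˡ-≤ n p) (≤-reflexive (sym (*-identityˡ (m * n)))))

rows∈O-area : (λ m _ → m) ∈O area
rows∈O-area = 1 , λ m n p q → ≤-trans (≤-reflexive (sym (*-identityʳ m)))
  (≤-trans (*-monoʳ-≤ m q) (≤-reflexive (sym (*-identityˡ (m * n)))))

gridLoop : ∀ a b k → (λ m n → a + m * suc (b + n * suc k)) ∈O area
gridLoop a b k = O-+ (O-const a area-positive) (O-loop (λ m _ → m) (λ m n p q → q)
  (O-+ (O-const b λ m n p q → q) (n-loop k)))
  where
  n-loop : ∀ k → (λ _ n → n * suc k) ∈O (λ _ n → n)
  n-loop k = suc k , λ m n p q → ≤-reflexive (*-comm n (suc k))

rowLoop : ∀ a k → (λ m _ → a + m * suc k) ∈O area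
rowLoop a k = O-+ (O-const a area-positive)
  (O-trans (suc k , λ m n p q → ≤-reflexive (*-comm m (suc k))) rows∈O-area)

colLoop : ∀ a k → (λ _ n → a + n * suc k) ∈O area
colLoop a k = O-+ (O-const a area-positive)
  (O-trans (suc k , λ m n p q → ≤-reflexive (*-comm n (suc k))) cols∈O-area)

-- There are `m * m` pairs `(k , l)`, each attempted in time O(area), with `m` the number of rows as
-- the search sees them.
searchBound : ℕ → ℕ → ℕ
searchBound m n = m * (m * area m n)

area∈O : area ∈O searchBound
area∈O = 1 , λ m n p q → ≤-trans (step p (area m n)) (≤-trans (step p (m * area m n)) (step ≤-refl (searchBound m n)))
  where
  step : ∀ {m} → 1 ≤ m → ∀ x → x ≤ m * x
  step p x = ≤-trans (≤-reflexive (sym (*-identityˡ x))) (*-monoˡ-≤ x p)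

searchBound-positive : Positive searchBound
searchBound-positive m n p q = *-mono-≤ p (*-mono-≤ p (area-positive m n p q))

module _ (slope overhead : ℕ) (mE nE : Exp ℕ) (r c : Array) where

  buildTime∈O : buildTime mE nE r c ∈O area
  buildTime∈O = O-+ (gridLoop (2 + cost mE) (2 + cost nE) (cellCost mE nE r c))
    (O-+ (colLoop (2 + cost nE) (columnCost mE nE r c)) (O-const (anchorCost mE nE r c) area-positive))

  attemptTime∈O : attemptTime slope overhead mE nE r c ∈O area
  attemptTime∈O =
    O-+ (O-+ (O-const 1 area-positive) buildTime∈O)
    (O-+ (O-+ (O-const (1 + cost mE + cost nE) area-positive)
              (O-+ (O-*ˡ slope (O-+ (O-*ˡ 4 (O-self area)) buildTime∈O)) (O-const overhead area-positive)))
         (O-+ (gridLoop (2 + cost mE) (2 + cost nE) 19) (O-const 1 area-positive)))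

  searchTime∈O : searchTime slope overhead mE nE r c ∈O searchBound
  searchTime∈O =
    O-+ (O-+ (O-const (2 + cost mE) searchBound-positive)
             (O-loop (λ m _ → m) inner (O-+ (O-const (2 + cost mE) inner)
               (O-loop (λ m _ → m) area-positive attemptTime∈O))))
        (O-const 1 searchBound-positive)
    where
    inner : Positive (λ m n → m * area m n)
    inner m n p q = *-mono-≤ p (area-positive m n p q)

-- Range checks, transposition and the main result

rangeTime : (N hi : Exp ℕ) → ℕ → ℕ
rangeTime N hi h = 2 + cost N + h * suc (4 + (3 + cost hi + 1))

after-range : ∀ S {Φ} s N a hi →
  (∀ i → 1 ≤ i → i ≤ value s N →
    ¬ (1 ≤ State.array s a i × State.array s a i ≤ value s hi) → Φ failure) →
  After (rangeTime N hi (value s N)) (_≡ s) Φ (run S (failUnlessInRange N a hi) s)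
after-range S {Φ} s N a hi bad = after-for S (λ _ → _≡ s) N check refl entryInRange refl
  where
  check : ℕ → Cmd ℕ
  check i = if # 1 ≤′ a [ ` i ] then (if a [ ` i ] ≤′ hi then skip else halt-failure) else halt-failure
  entryInRange : ∀ i → 1 ≤ i → i ≤ value s N → ∀ s′ → s′ ≡ s →
    After (4 + (3 + cost hi + 1)) (_≡ s) Φ (run S (check i) s′)
  entryInRange i p q _ refl = after-if S {s = s} (# 1) (a [ ` i ]) (if a [ ` i ] ≤′ hi then skip else halt-failure) halt-failure
    (λ u → after-if S {s = s} (a [ ` i ]) hi skip halt-failure
      (λ v → ≤-refl , continues refl)
      (λ ¬v → ≤-refl , fails (bad i p q λ (_ , v) → ¬v v)))
    (λ ¬u → s≤s z≤n , fails (bad i p q λ (u , _) → ¬u u))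

transpose : ∀ {m n} → Object m n → Object n m
transpose T i j = T j i

IsSolution-transpose : ∀ {m n} {r : Vector ℕ m} {c : Vector ℕ n} {T : Object m n} →
  IsSolution r c T → IsSolution c r (transpose T)
IsSolution-transpose {T = T} ((connected , hconvex , vconvex) , (rows , cols)) =
  (connected′ , vconvex , hconvex) , (cols , rows)
  where
  connected′ : IsPolyomino (transpose T)
  connected′ ((i , j) , e) ((i′ , j′) , e′) =
    gmap {T = Adjacent T} {U = Adjacent (transpose T)} (λ { ((x , y) , u) → (y , x) , u })
      (λ { {(x , y) , _} {(x′ , y′) , _} → subst (_≤ 1) (+-comm ∣ toℕ x - toℕ x′ ∣ ∣ toℕ y - toℕ y′ ∣) })
      (connected ((j , i) , e) ((j′ , i′) , e′))

module Correctness (S : Solver) (linearTime : IsLinearTime2SAT S) {m n : ℕ} (r : Vector ℕ m) (c : Vector ℕ n)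
  (1≤m : 1 ≤ m) (1≤n : 1 ≤ n) (rpos : ∀ i → 1 ≤ r i) (cpos : ∀ j → 1 ≤ c j) (balanced : sum r ≡ sum c) where

  open IsLinearTime2SAT linearTime using (slope; overhead)

  Correct : Outcome → Set
  Correct (running _) = ⊥
  Correct (success o) = ∃ λ T → (∀ i j → T i j ≡ o (position i) (position j)) × IsSolution r c T
  Correct failure     = ¬ ∃ (IsSolution r c)

  -- A row of a realization has at most `n` cells, so when the check fails there is no solution and
  -- reporting failure is right.
  rowsInRange : ∀ i → 1 ≤ i → i ≤ m → ¬ (1 ≤ entry r i × entry r i ≤ n) → ¬ ∃ (IsSolution r c)
  rowsInRange i p q bad (T , _ , rows , _) with isPosition p q
  ... | at x = bad (subst (λ y → 1 ≤ y × y ≤ n) (sym (entry-position r x))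
    (rpos x , subst (_≤ n) (rows x) (count≤n (T x))))

  colsInRange : ∀ j → 1 ≤ j → j ≤ n → ¬ (1 ≤ entry c j × entry c j ≤ m) → ¬ ∃ (IsSolution r c)
  colsInRange j p q bad (T , _ , _ , cols) with isPosition p q
  ... | at y = bad (subst (λ z → 1 ≤ z × z ≤ m) (sym (entry-position c y))
    (cpos y , subst (_≤ m) (cols y) (count≤n (λ x → T x y))))

  module Straight = Search S linearTime (input r c) #rows #cols rowSums colSums (straightWriter S)
  module Transposed = Search S linearTime (input r c) #cols #rows colSums rowSums (transposedWriter S)

  straight-correct : ∀ o → Straight.Verdict o → Correct o
  straight-correct (success o) (k , l , α , (cells , columns , _) , agree) =
    Sound.T , (λ i j → sym (agree _ _ ((1≤position i , position≤n i) , (1≤position j , position≤n j)))) ,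
    Sound.solution rpos balanced
    where module Sound = Soundness r c k l (extend m n α) (extend-outside m n α) cells columns
  straight-correct failure none solution =
    let k , l , (p , q) , (p′ , q′) , sat = satisfiable r c 1≤n rpos cpos solution
    in  none k p q l p′ q′ sat

  -- This search treats the instance `(c , r)`; solutions are transposed on the way in and out.
  transposed-correct : ∀ o → Transposed.Verdict o → Correct o
  transposed-correct (success o) (k , l , α , (cells , columns , _) , agree) =
    transpose Sound.T , (λ i j → sym (agree _ _ ((1≤position j , position≤n j) , (1≤position i , position≤n i)))) ,
    IsSolution-transpose (Sound.solution cpos (sym balanced))
    where module Sound = Soundness c r k l (extend n m α) (extend-outside n m α) cells columns
  transposed-correct failure none (T , solution) =
    let k , l , (p , q) , (p′ , q′) , sat = satisfiable c r 1≤m cpos rpos (transpose T , IsSolution-transpose solution)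
    in  none k p q l p′ q′ sat

  straightSearch transposedSearch mainCommand : Cmd ℕ
  straightSearch = search #rows #cols rowSums colSums write
  transposedSearch = search #cols #rows colSums rowSums (λ i j → write j i)
  mainCommand = if #rows ≤′ #cols then straightSearch else transposedSearch

  after-checks : ∀ {t} d → After t (λ _ → ⊥) Correct (run S d (input r c)) →
    After (rangeTime #rows #cols m + (rangeTime #cols #rows n + t)) (λ _ → ⊥) Correct
      (run S (failUnlessInRange #rows rowSums #cols ⨾ failUnlessInRange #cols colSums #rows ⨾ d) (input r c))
  after-checks d h =
    after-andThen (after-range S (input r c) #rows rowSums #cols rowsInRange) λ { _ refl →
    after-andThen (after-range S (input r c) #cols colSums #rows colsInRange) λ { _ refl → h } }

  straight : m ≤ n → After
    (rangeTime #rows #cols m + (rangeTime #cols #rows n +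
      (3 + searchTime slope overhead #rows #cols rowSums colSums m n)))
    (λ _ → ⊥) Correct (Algorithm1.execution S r c)
  straight m≤n = after-checks mainCommand (after-if S {s = input r c} #rows #cols straightSearch transposedSearch
    (λ _ → after-outcome straight-correct Straight.after-search) (contradiction m≤n))

  transposed : ¬ m ≤ n → After
    (rangeTime #rows #cols m + (rangeTime #cols #rows n +
      (3 + searchTime slope overhead #cols #rows colSums rowSums n m)))
    (λ _ → ⊥) Correct (Algorithm1.execution S r c)
  transposed m≰n = after-checks mainCommand (after-if S {s = input r c} #rows #cols straightSearch transposedSearch
    (λ m≤n → contradiction m≤n m≰n) (λ _ → after-outcome transposed-correct Transposed.after-search))

  conclusion : ∀ {t} → After t (λ _ → ⊥) Correct (Algorithm1.execution S r c) →
    (∃ (IsSolution r c) → ∃ λ T → Algorithm1.Outputs S r c T × IsSolution r c T)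
    × (¬ ∃ (IsSolution r c) → Algorithm1.OutputsFailure S r c)
    × Algorithm1.runningTime S r c ≤ t
  conclusion {t} (time≤ , result) = proj₁ (outcome result) , proj₂ (outcome result) , time≤
    where
    outcome : ∀ {o} → Result (λ _ → ⊥) Correct o →
      (∃ (IsSolution r c) → ∃ λ T → (∃ λ out → o ≡ success out ×
        (∀ i j → T i j ≡ out (position i) (position j))) × IsSolution r c T)
      × (¬ ∃ (IsSolution r c) → o ≡ failure)
    outcome (succeeds (T , agree , solution)) =
      (λ _ → T , (_ , refl , agree) , solution) , λ none → contradiction (T , solution) none
    outcome (fails none) = (λ solution → contradiction solution none) , λ _ → refl

totalTime∈O : ∀ slope overhead mE nE r c a b →
  (λ m n → (a + m * suc b) + ((a + n * suc b) + (3 + searchTime slope overhead mE nE r c m n)))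
    ∈O searchBound
totalTime∈O slope overhead mE nE r c a b =
  O-+ (O-trans (rowLoop a b) area∈O) (O-+ (O-trans (colLoop a b) area∈O)
    (O-+ (O-const 3 searchBound-positive) (searchTime∈O slope overhead mE nE r c)))

searchBound≡ : ∀ m n → m ≤ n → searchBound m n ≡ m * n * (m ^ 2 ⊓ n ^ 2)
searchBound≡ m n m≤n rewrite m≤n⇒m⊓n≡m (^-monoˡ-≤ 2 m≤n) | *-identityʳ m =
  trans (sym (*-assoc m m (m * n))) (*-comm (m * m) (m * n))

Specification : Solver → ℕ → Set
Specification S K = (m n : ℕ) (r : Vector ℕ m) (c : Vector ℕ n) →
    1 ≤ m → 1 ≤ n → (∀ i → 1 ≤ r i) → (∀ j → 1 ≤ c j) → sum r ≡ sum c →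
    (∃ (IsSolution r c) → ∃ λ T → Algorithm1.Outputs S r c T × IsSolution r c T)
    × (¬ ∃ (IsSolution r c) → Algorithm1.OutputsFailure S r c)
    × Algorithm1.runningTime S r c ≤ K * (m * n * (m ^ 2 ⊓ n ^ 2))

-- The time bounds are arguments so that their constants, huge closed numerals, are never unfolded.
specification : (S : Solver) (linearTime : IsLinearTime2SAT S) →
  let open IsLinearTime2SAT linearTime in
  (λ m n → rangeTime #rows #cols m + (rangeTime #cols #rows n +
    (3 + searchTime slope overhead #rows #cols rowSums colSums m n))) ∈O searchBound →
  (λ m n → rangeTime #cols #rows m + (rangeTime #rows #cols n +
    (3 + searchTime slope overhead #cols #rows colSums rowSums m n))) ∈O searchBound →
  ∃ (Specification S)
specification S linearTime (K₁ , bound₁) (K₂ , bound₂) = K₁ + K₂ , correct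
  where
  correct : Specification S (K₁ + K₂)
  correct m n r c 1≤m 1≤n rpos cpos balanced = byCases (m ≤? n)
    where
    open Correctness S linearTime r c 1≤m 1≤n rpos cpos balanced
    swap : ∀ x y z → x + (y + z) ≡ y + (x + z)
    swap x y z = trans (sym (+-assoc x y z)) (trans (cong (_+ z) (+-comm x y)) (+-assoc y x z))
    flipped : ¬ m ≤ n → searchBound n m ≡ m * n * (m ^ 2 ⊓ n ^ 2)
    flipped m≰n = trans (searchBound≡ n m (≰⇒≥ m≰n)) (cong₂ _*_ (*-comm n m) (⊓-comm (n ^ 2) (m ^ 2)))
    byCases : Dec (m ≤ n) → _
    byCases (yes m≤n) = conclusion (after-weaken
      (≤-trans (bound₁ m n 1≤m 1≤n) (*-mono-≤ (m≤m+n K₁ K₂) (≤-reflexive (searchBound≡ m n m≤n))))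
      (λ _ ()) (straight m≤n))
    byCases (no m≰n) = conclusion (after-weaken
      -- `bound₂` takes the number of columns first, while the program still checks the rows first;
      -- `swap` reconciles the two orders.
      (≤-trans (≤-reflexive (swap (rangeTime #rows #cols m) (rangeTime #cols #rows n) _))
        (≤-trans (bound₂ n m 1≤n 1≤m) (*-mono-≤ (m≤n+m K₂ K₁) (≤-reflexive (flipped m≰n)))))
      (λ _ ()) (transposed m≰n))

theorem3 : (S : Solver) → IsLinearTime2SAT S →
    ∃ λ K → (m n : ℕ) (r : Vector ℕ m) (c : Vector ℕ n) →
    1 ≤ m → 1 ≤ n → (∀ i → 1 ≤ r i) → (∀ j → 1 ≤ c j) → sum r ≡ sum c →
    (∃ (IsSolution r c) → ∃ λ T → Algorithm1.Outputs S r c T × IsSolution r c T)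
    × (¬ ∃ (IsSolution r c) → Algorithm1.OutputsFailure S r c)
    × Algorithm1.runningTime S r c ≤ K * (m * n * (m ^ 2 ⊓ n ^ 2))
theorem3 S linearTime = specification S linearTime
  -- A range check costs 3 for the loop header, and each pass costs 9: two comparisons at 4 and a
  -- final instruction.
  (totalTime∈O slope overhead #rows #cols rowSums colSums 3 9)
  (totalTime∈O slope overhead #cols #rows colSums rowSums 3 9)
  where open IsLinearTime2SAT linearTime
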